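{- Let $G=(V(G),E(G),w)$ be a finite weighted graph with $w:E(G)\to\mathbb{R}_{\ge 0}$ and order $n\ge 3$. Then $G$ admits a $3$-partition $(X_1,X_2,X_3)$ of $V(G)$ into three non-empty parts such that both (i) $w(X_1,X_2,X_3)\ge \frac{2w(G)}{3}+\frac{d_w(G)}{3}$, and (ii) $\max\{w(G[X_1]),w(G[X_2]),w(G[X_3])\}\le \frac{w(G)}{9}+\frac{\Delta_w(G)}{9}$.
   Context: For a weighted graph $G$, $w(G)$ is the total weight of its edges and $w(G[S])$ is the total weight of edges with both endpoints in $S\subseteq V(G)$. The weighted degree of a vertex $v$ is $w(v)=\sum_{u\in N(v)}w(vu)$; $\Delta_w(G)=\max_{v}w(v)$ is the maximum weighted degree and $d_w(G)=\frac{2w(G)}{|V(G)|}$ is the average weighted degree. For disjoint non-empty sets $X_1,\dots,X_k$, $w(X_1,\dots,X_k)$ denotes the total weight of edges with endpoints in two different sets $X_i,X_j$, $i\ne j$.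
   Formalization: The edge weights are taken to be nonnegative rational numbers instead of nonnegative real numbers. -}

module Defs where

open import Data.Nat using (ℕ; zero; suc)
open import Data.Fin using (Fin; zero; suc) renaming (_<?_ to _<ᶠ?_)
open import Data.Fin.Properties using () renaming (_≟_ to _≟ᶠ_)
open import Data.Integer using (+_)
open import Data.Rational using (ℚ; 0ℚ; _+_; _*_; _/_; _⊔_; _≤_)
open import Data.Bool using (Bool; if_then_else_; _∧_; not)
open import Relation.Nullary using (does)
open import Relation.Binary.PropositionalEquality using (_≡_)
open import Data.Product using (∃)

Σ : ∀ n → (Fin n → ℚ) → ℚ
Σ zero    f = 0ℚ
Σ (suc n) f = f zero + Σ n (λ i → f (suc i))

-- Maximum of a ℚ-valued function over Fin n (0 for n = 0; only used for n ≥ 3).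
Max : ∀ n → (Fin n → ℚ) → ℚ
Max zero          f = 0ℚ
Max (suc zero)    f = f zero
Max (suc (suc n)) f = f zero ⊔ Max (suc n) (λ i → f (suc i))

-- A finite simple weighted graph on vertex set Fin n.  The weight function is
-- given on all ordered pairs; a non-edge is a pair of weight 0 (which does not
-- affect any of the quantities below).  Weights are nonnegative, symmetric,
-- and there are no loops.
record WGraph (n : ℕ) : Set where
  field
    w     : Fin n → Fin n → ℚ
    nonneg : ∀ i j → 0ℚ ≤ w i j
    sym   : ∀ i j → w i j ≡ w j i
    loopless : ∀ i → w i i ≡ 0ℚ
open WGraph public

pairSum : ∀ {n} → WGraph n → (Fin n → Fin n → Bool) → ℚ
pairSum {n} G P =
  Σ n (λ i → Σ n (λ j → if does (i <ᶠ? j) ∧ P i j then w G i j else 0ℚ))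

totalW : ∀ {n} → WGraph n → ℚ
totalW G = pairSum G (λ _ _ → Bool.true)
  where import Data.Bool as Bool

wdeg : ∀ {n} → WGraph n → Fin n → ℚ
wdeg {n} G v = Σ n (λ u → w G v u)

maxWDeg : ∀ {n} → WGraph n → ℚ
maxWDeg {n} G = Max n (wdeg G)

-- d_w(G) = 2 w(G) / |V(G)|  (set to 0 for the empty graph, never used)
avgWDeg : ∀ {n} → WGraph n → ℚ
avgWDeg {zero}  G = 0ℚ
avgWDeg {suc m} G = ((+ 2) / 1) * totalW G * ((+ 1) / suc m)

-- A 3-partition is a map Fin n → Fin 3 (part labels); parts nonempty = surjective.
Partition3 : ℕ → Set
Partition3 n = Fin n → Fin 3

NonEmptyParts : ∀ {n} → Partition3 n → Set
NonEmptyParts {n} f = ∀ (k : Fin 3) → ∃ λ (v : Fin n) → f v ≡ k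

crossW : ∀ {n} → WGraph n → Partition3 n → ℚ
crossW G f = pairSum G (λ i j → not (does (f i ≟ᶠ f j)))

insideW : ∀ {n} → WGraph n → Partition3 n → Fin 3 → ℚ
insideW G f k = pairSum G (λ i j → does (f i ≟ᶠ k) ∧ does (f j ≟ᶠ k))

{-# OPTIONS --safe #-}

-- Weights are doubled: for a vertex set with indicator function χ, E χ = Σᵤᵥ w(u,v) χ(u) χ(v) is
-- twice the weight inside it, T = E 𝟙 is 2w(G), and D is Δ_w(G).
--
-- Take a 3-partition of minimum inside weight. It satisfies (i), by comparison with a random
-- balanced partition. If some part X violates (ii), every v ∈ X sends at least twice as much weight
-- to Y = V ∖ X as into X. Delete vertices from X until it is minimal with 9 w(X) > w(G) + Δ, and then
-- move one more vertex, chosen by averaging, from X to Y. Now w(X) ≤ (w(G) + Δ)/9,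
-- 2w(X) + w(Y) ≤ (2w(G) - Δ)/3, w(Y) ≤ (4w(G) + Δ)/9, and a balanced split of Y gives (i).
-- These properties are kept while Y is split optimally. If a half Z of Y is too heavy, shrink it
-- to a minimal too heavy set and take u ∈ Z. Either u can be moved to the other half, which
-- finishes the proof with inside weight at most (w(G) - Δ)/3, or u can be moved back to X without
-- losing the invariants, and Y has become smaller.

module Submission where

open import Defs
open import Data.Nat using (ℕ) renaming (_≤_ to _≤ℕ_)
open import Data.Fin using (Fin; zero; suc)
open import Data.Integer using (+_)
open import Data.Rational using (ℚ; _+_; _*_; _/_; _⊔_; _≤_)
open import Data.Product using (Σ-syntax; _×_)

open import Data.Bool using (Bool; true; false; if_then_else_; _∧_; not)
open import Data.Bool.Properties using (∧-comm) renaming (_≟_ to _≟ᵇ_)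
open import Data.Empty using (⊥-elim)
open import Data.Fin using (_<?_; punchOut) renaming (_<_ to _<ᶠ_)
open import Data.Fin.Properties using (any?; all?; ¬∀⟶∃¬; _≟_; pigeonhole; punchOut-injective)
import Data.Fin.Properties as Fin
import Data.Integer as ℤ
open import Data.Integer.Tactic.RingSolver using () renaming (solve-∀ to ℤ-solve-∀)
open import Data.Nat using (zero; suc)
import Data.Nat as ℕ
import Data.Nat.Properties as ℕ
open import Data.Product using (∃; _,_; proj₁; proj₂)
open import Data.Rational using (0ℚ; 1ℚ; _-_; -_; _<_; nonNegative; positive; toℚᵘ)
open import Data.Rational.Properties hiding (_≟_; _<?_)
import Data.Rational.Properties as ℚ
open import Data.Rational.Unnormalised using (mkℚᵘ; *≡*)
import Data.Rational.Unnormalised as ℚᵘ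
import Data.Rational.Unnormalised.Properties as ℚᵘ
open import Data.Sum using (_⊎_; inj₁; inj₂)
open import Data.Vec.Functional using (_∷_)
open import Function using (_∘_; case_of_)
open import Relation.Binary.Definitions using (Tri; tri<; tri≈; tri>)
open import Relation.Binary.PropositionalEquality using (_≡_; _≢_; refl; trans; cong; cong₂; subst; subst₂; module ≡-Reasoning) renaming (sym to ≡-sym)
open import Relation.Nullary using (¬_; Dec; yes; no; does; contradiction)
open import Relation.Nullary.Decidable using (dec⇒maybe; _×-dec_; dec-true; dec-false)
open import Tactic.RingSolver using (solve-∀)
open import Tactic.RingSolver.Core.AlmostCommutativeRing using (AlmostCommutativeRing; fromCommutativeRing)

-- Relieving a part pushes weight elsewhere, and (i) leaves little room for that. What pays for each
-- move is that the relieved set is too heavy. Optimality gives every vertex of it a nonnegative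
-- gain, so the gain of one vertex is at most the total over the set, where the weight of the set
-- enters with a negative sign. These degree conditions survive shrinking, because the weight into
-- the own part only drops. The constants are fitted to each other. After a transfer out of a too
-- heavy half Z the inside weight is at most w(X) + w(Y) - 2w(Z), which is half of 2w(X) + w(Y),
-- plus half of w(Y), minus 2w(Z). The three bounds add up to (w(G) - Δ)/3, and (i) follows because
-- the average degree is at most Δ. If the transfer is blocked, u sends at least Δ/3 into each half
-- of Y, so at most Δ/3 is left towards X. Nonemptiness is postponed to the end: moving a vertex
-- into an empty part makes no part heavier.

ring : AlmostCommutativeRing _ _
ring = fromCommutativeRing +-*-commutativeRing (λ x → dec⇒maybe (0ℚ ℚ.≟ x))

-- Rational constants and certified inequalities

#_ : ℕ → ℚ
# k = + k / 1

infixl 6 _⊕_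
infixl 7 _⊗_
infixr 8 _·_

_⊕_ : ∀ {p q} → 0ℚ ≤ p → 0ℚ ≤ q → 0ℚ ≤ p + q
_⊕_ = +-mono-≤

_⊗_ : ∀ {p q} → 0ℚ ≤ p → 0ℚ ≤ q → 0ℚ ≤ p * q
_⊗_ {p} {q} h k = subst (_≤ p * q) (*-zeroʳ p) (*-monoˡ-≤-nonNeg p {{nonNegative h}} k)

0≤# : ∀ k → 0ℚ ≤ # k
0≤# k = nonNegative⁻¹ (# k) {{normalize-nonNeg k 1}}

_·_ : ∀ k {p} → 0ℚ ≤ p → 0ℚ ≤ # k * p
k · h = 0≤# k ⊗ h

slack : ∀ {p q} → p ≤ q → 0ℚ ≤ q - p
slack {p} {q} h = subst (_≤ q - p) (+-inverseʳ p) (+-monoˡ-≤ (- p) h)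

-- Every inequality below is certified by writing the difference of its two sides (possibly times a
-- positive factor) as a nonnegative combination of slacks of the hypotheses.
≤-by : ∀ {p q r} → 0ℚ ≤ r → r ≡ q - p → p ≤ q
≤-by {p} {q} h eq = subst₂ _≤_ (+-identityˡ p) (lemma p q) (+-monoˡ-≤ p (subst (0ℚ ≤_) eq h))
  where
  lemma : ∀ p q → q - p + p ≡ q
  lemma = solve-∀ ring

cancel-≤ : ∀ {p q r s} → 0ℚ < r → 0ℚ ≤ s → s ≡ r * (q - p) → p ≤ q
cancel-≤ {p} {q} {r} {s} r>0 h eq = ≤-by (*-cancelˡ-≤-pos r {{positive r>0}} (subst₂ _≤_ (≡-sym (*-zeroʳ r)) eq h)) refl

-- Opaque, because unfolding the gcd computation in _/_ makes conversion checking infeasible.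
opaque
  ν recip : ℕ → ℚ
  ν k     = + k / 1
  recip k = + 1 / suc k

  ν-def : ∀ k → ν k ≡ # k
  ν-def k = refl

  recip-def : ∀ k → recip k ≡ + 1 / suc k
  recip-def k = refl

  0≤ν : ∀ k → 0ℚ ≤ ν k
  0≤ν = 0≤#

  ν-suc : ∀ k → ν (suc k) ≡ ν k + 1ℚ
  ν-suc k = toℚᵘ-injective (begin
    toℚᵘ (ν (suc k))            ≈⟨ toℚᵘ-fromℚᵘ (mkℚᵘ (+ suc k) 0) ⟩
    mkℚᵘ (+ suc k) 0            ≈⟨ *≡* (eq (+ k)) ⟩
    mkℚᵘ (+ k) 0 ℚᵘ.+ ℚᵘ.1ℚᵘ     ≈⟨ ℚᵘ.+-cong (ℚᵘ.≃-sym (toℚᵘ-fromℚᵘ (mkℚᵘ (+ k) 0))) ℚᵘ.≃-refl ⟩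
    toℚᵘ (ν k) ℚᵘ.+ toℚᵘ 1ℚ     ≈⟨ ℚᵘ.≃-sym (toℚᵘ-homo-+ (ν k) 1ℚ) ⟩
    toℚᵘ (ν k + 1ℚ)             ∎)
    where
    open import Relation.Binary.Reasoning.Setoid ℚᵘ.≃-setoid
    eq : ∀ x → (+ 1 ℤ.+ x) ℤ.* + 1 ≡ (x ℤ.* + 1 ℤ.+ + 1 ℤ.* + 1) ℤ.* + 1
    eq = ℤ-solve-∀

  ν-recip : ∀ k → ν (suc k) * recip k ≡ 1ℚ
  ν-recip k = toℚᵘ-injective (begin
    toℚᵘ (ν (suc k) * recip k)               ≈⟨ toℚᵘ-homo-* (ν (suc k)) (recip k) ⟩
    toℚᵘ (ν (suc k)) ℚᵘ.* toℚᵘ (recip k)     ≈⟨ ℚᵘ.*-cong (toℚᵘ-fromℚᵘ (mkℚᵘ (+ suc k) 0)) (toℚᵘ-fromℚᵘ (mkℚᵘ (+ 1) k)) ⟩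
    mkℚᵘ (+ suc k) 0 ℚᵘ.* mkℚᵘ (+ 1) k       ≈⟨ *≡* (eq (+ suc k)) ⟩
    ℚᵘ.1ℚᵘ                                   ∎)
    where
    open import Relation.Binary.Reasoning.Setoid ℚᵘ.≃-setoid
    eq : ∀ x → x ℤ.* + 1 ℤ.* + 1 ≡ + 1 ℤ.* (+ 1 ℤ.* x)
    eq = ℤ-solve-∀

  0<ν-suc : ∀ k → 0ℚ < ν (suc k)
  0<ν-suc k = positive⁻¹ (ν (suc k)) {{normalize-pos (suc k) 1}}

-- Finite sums

Σ-cong : ∀ n {f g : Fin n → ℚ} → (∀ i → f i ≡ g i) → Σ n f ≡ Σ n g
Σ-cong zero    h = refl
Σ-cong (suc n) h = cong₂ _+_ (h zero) (Σ-cong n (h ∘ suc))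

Σ-zero : ∀ n → Σ n (λ _ → 0ℚ) ≡ 0ℚ
Σ-zero zero    = refl
Σ-zero (suc n) = trans (+-identityˡ _) (Σ-zero n)

Σ-+ : ∀ n (f g : Fin n → ℚ) → Σ n (λ i → f i + g i) ≡ Σ n f + Σ n g
Σ-+ zero    f g = refl
Σ-+ (suc n) f g = trans (cong (λ z → f zero + g zero + z) (Σ-+ n (f ∘ suc) (g ∘ suc)))
                        (interchange (f zero) (g zero) (Σ n (f ∘ suc)) (Σ n (g ∘ suc)))
  where
  interchange : ∀ a b c d → a + b + (c + d) ≡ a + c + (b + d)
  interchange = solve-∀ ring

Σ-* : ∀ n c (f : Fin n → ℚ) → Σ n (λ i → c * f i) ≡ c * Σ n f
Σ-* zero    c f = ≡-sym (*-zeroʳ c)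
Σ-* (suc n) c f = trans (cong (λ z → c * f zero + z) (Σ-* n c (f ∘ suc)))
                        (≡-sym (*-distribˡ-+ c (f zero) (Σ n (f ∘ suc))))

Σ-const : ∀ n c → Σ n (λ _ → c) ≡ ν n * c
Σ-const zero    c = ≡-sym (trans (cong (_* c) (ν-def 0)) (*-zeroˡ c))
Σ-const (suc n) c = trans (cong (λ z → c + z) (Σ-const n c))
                      (trans (lemma (ν n) c) (cong (_* c) (≡-sym (ν-suc n))))
  where
  lemma : ∀ k c → c + k * c ≡ (k + 1ℚ) * c
  lemma = solve-∀ ring

Σ-comm : ∀ m n (f : Fin m → Fin n → ℚ) → Σ m (λ i → Σ n (f i)) ≡ Σ n (λ j → Σ m (λ i → f i j))
Σ-comm zero    n f = ≡-sym (Σ-zero n)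
Σ-comm (suc m) n f = trans (cong (λ z → Σ n (f zero) + z) (Σ-comm m n (f ∘ suc)))
                           (≡-sym (Σ-+ n (f zero) (λ j → Σ m (λ i → f (suc i) j))))

Σ-mono : ∀ n {f g : Fin n → ℚ} → (∀ i → f i ≤ g i) → Σ n f ≤ Σ n g
Σ-mono zero    h = ≤-refl
Σ-mono (suc n) h = +-mono-≤ (h zero) (Σ-mono n (h ∘ suc))

Σ-nonneg : ∀ n {f : Fin n → ℚ} → (∀ i → 0ℚ ≤ f i) → 0ℚ ≤ Σ n f
Σ-nonneg n {f} h = subst (_≤ Σ n f) (Σ-zero n) (Σ-mono n h)

term≤Σ : ∀ n {f : Fin n → ℚ} → (∀ i → 0ℚ ≤ f i) → ∀ v → f v ≤ Σ n f
term≤Σ (suc n) {f} h zero    = ≤-by (Σ-nonneg n (h ∘ suc)) (lemma (f zero) _)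
  where
  lemma : ∀ a b → b ≡ a + b - a
  lemma = solve-∀ ring
term≤Σ (suc n) {f} h (suc v) = ≤-trans (term≤Σ n (h ∘ suc) v) (≤-by (h zero) (lemma (f zero) _))
  where
  lemma : ∀ a b → a ≡ a + b - b
  lemma = solve-∀ ring

bit : Bool → ℚ
bit b = if b then 1ℚ else 0ℚ

0≤bit : ∀ b → 0ℚ ≤ bit b
0≤bit true  = 0≤# 1
0≤bit false = ≤-refl

-- Sets are compared through rational-valued functions, so that complements and deletions become
-- subtraction and every change of weight follows from bilinearity.
Fun : ℕ → Set
Fun n = Fin n → ℚ

𝟙 𝟘 : ∀ {n} → Fun n
𝟙 _ = 1ℚ
𝟘 _ = 0ℚ

δ : ∀ {n} → Fin n → Fun n
δ v i = bit (does (v ≟ i))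

Σ-δ : ∀ n v (f : Fun n) → Σ n (λ i → δ v i * f i) ≡ f v
Σ-δ (suc n) zero    f = trans (cong₂ _+_ (*-identityˡ (f zero)) (trans (Σ-cong n (λ i → *-zeroˡ (f (suc i)))) (Σ-zero n))) (+-identityʳ (f zero))
Σ-δ (suc n) (suc v) f = trans (cong₂ _+_ (*-zeroˡ (f zero)) (Σ-δ n v (f ∘ suc))) (+-identityˡ _)

infixl 6 _⊞_ _⊟_
_⊞_ _⊟_ : ∀ {n} → Fun n → Fun n → Fun n
(χ ⊞ ψ) i = χ i + ψ i
(χ ⊟ ψ) i = χ i - ψ i

-- Vertex sets

VSet : ℕ → Set
VSet n = Fin n → Bool

infix 4 _∈_ _⊆_
_∈_ : ∀ {n} → Fin n → VSet n → Set
v ∈ X = X v ≡ true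

_⊆_ : ∀ {n} → VSet n → VSet n → Set
X ⊆ Y = ∀ {v} → v ∈ X → v ∈ Y

ind : ∀ {n} → VSet n → Fun n
ind X i = bit (X i)

∁ : ∀ {n} → VSet n → VSet n
∁ X i = not (X i)

infixl 6 _∖_
_∖_ : ∀ {n} → VSet n → Fin n → VSet n
(X ∖ v) i = X i ∧ not (does (v ≟ i))

ind-∁ : ∀ {n} (X : VSet n) i → ind (∁ X) i ≡ (𝟙 ⊟ ind X) i
ind-∁ X i with X i
... | true  = refl
... | false = refl

ind-∖ : ∀ {n} (X : VSet n) {v} → v ∈ X → ∀ i → ind (X ∖ v) i ≡ (ind X ⊟ δ v) i
ind-∖ X {v} v∈X i with v ≟ i
... | yes refl rewrite v∈X = refl
... | no _ with X i
...   | true  = refl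
...   | false = refl

∖-⊆ : ∀ {n} (X : VSet n) v → X ∖ v ⊆ X
∖-⊆ X v {i} h with X i
... | true = refl

size : ∀ {n} → VSet n → ℕ
size {zero}  X = 0
size {suc n} X = (if X zero then suc else λ k → k) (size (X ∘ suc))

ν-size : ∀ {n} (X : VSet n) → ν (size X) ≡ Σ n (ind X)
ν-size {zero}  X = ν-def 0
ν-size {suc n} X with X zero
... | true  = trans (ν-suc (size (X ∘ suc))) (trans (+-comm (ν (size (X ∘ suc))) 1ℚ) (cong (λ z → 1ℚ + z) (ν-size (X ∘ suc))))
... | false = trans (ν-size (X ∘ suc)) (≡-sym (+-identityˡ _))

size-cong : ∀ {n} {X Y : VSet n} → (∀ i → X i ≡ Y i) → size X ≡ size Y
size-cong {zero}  h = refl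
size-cong {suc n} h = cong₂ (λ b k → (if b then suc else λ k → k) k) (h zero) (size-cong (h ∘ suc))

size-∖ : ∀ {n} (X : VSet n) {v} → v ∈ X → size X ≡ suc (size (X ∖ v))
size-∖ {suc n} X {zero}  h rewrite h = cong suc (size-cong (λ i → lemma (X (suc i))))
  where
  lemma : ∀ b → b ≡ b ∧ true
  lemma true  = refl
  lemma false = refl
size-∖ {suc n} X {suc v} h with X zero
... | true  = cong suc (size-∖ (X ∘ suc) h)
... | false = size-∖ (X ∘ suc) h

size-∁ : ∀ {n} (X : VSet n) → size X ℕ.+ size (∁ X) ≡ n
size-∁ {zero}  X = refl
size-∁ {suc n} X with X zero
... | true  = cong suc (size-∁ (X ∘ suc))
... | false = trans (ℕ.+-suc _ _) (cong suc (size-∁ (X ∘ suc)))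

∈? : ∀ {n} (X : VSet n) v → Dec (v ∈ X)
∈? X v = X v ≟ᵇ true

size⁺⇒∃ : ∀ {n} (X : VSet n) {k} → size X ≡ suc k → ∃ λ v → v ∈ X
size⁺⇒∃ {suc n} X h with X zero in eq
... | true  = zero , eq
... | false = let v , v∈ = size⁺⇒∃ (X ∘ suc) h in suc v , v∈

-- If all members exceeded the mean, their deviations would be nonnegative with a positive one among
-- them, yet they sum to zero. The mean is multiplied by the size of `X` to avoid division.
average : ∀ {n} (X : VSet n) {k} → size X ≡ suc k → (f : Fun n) →
          ∃ λ v → v ∈ X × ν (suc k) * f v ≤ Σ n (λ i → ind X i * f i)
average {n} X {k} hX f with any? (λ v → ∈? X v ×-dec (ν (suc k) * f v ≤? Σ n (λ i → ind X i * f i)))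
... | yes (v , p) = v , p
... | no ¬p = ⊥-elim (<-irrefl total (<-≤-trans (slack< (larger v₀ v₀∈X)) (subst (_≤ Σ n g) single (term≤Σ n nonneg′ v₀))))
  where
  S = Σ n (λ i → ind X i * f i)
  g = λ i → ind X i * (ν (suc k) * f i - S)
  v₀v = size⁺⇒∃ X hX
  v₀ = proj₁ v₀v
  v₀∈X = proj₂ v₀v
  larger : ∀ v → v ∈ X → S < ν (suc k) * f v
  larger v v∈X = ≰⇒> (λ h → ¬p (v , v∈X , h))
  slack< : ∀ {p q} → p < q → 0ℚ < q - p
  slack< {p} {q} h = subst (_< q - p) (+-inverseʳ p) (+-monoˡ-< (- p) h)
  nonneg′ : ∀ i → 0ℚ ≤ ind X i * (ν (suc k) * f i - S)
  nonneg′ i with X i in eq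
  ... | true  = subst (0ℚ ≤_) (≡-sym (*-identityˡ _)) (<⇒≤ (slack< (larger i eq)))
  ... | false = ≤-reflexive (≡-sym (*-zeroˡ (ν (suc k) * f i - S)))
  single : ind X v₀ * (ν (suc k) * f v₀ - S) ≡ ν (suc k) * f v₀ - S
  single rewrite v₀∈X = *-identityˡ _
  total : 0ℚ ≡ Σ n (λ i → ind X i * (ν (suc k) * f i - S))
  total = ≡-sym (begin
    Σ n (λ i → ind X i * (ν (suc k) * f i - S))
      ≡⟨ Σ-cong n (λ i → lem (ind X i) (ν (suc k)) (f i) S) ⟩
    Σ n (λ i → ν (suc k) * (ind X i * f i) + - S * ind X i)
      ≡⟨ Σ-+ n _ _ ⟩
    Σ n (λ i → ν (suc k) * (ind X i * f i)) + Σ n (λ i → - S * ind X i)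
      ≡⟨ cong₂ _+_ (Σ-* n (ν (suc k)) _) (Σ-* n (- S) _) ⟩
    ν (suc k) * S + - S * Σ n (ind X)
      ≡⟨ cong (λ z → ν (suc k) * S + - S * z) (trans (≡-sym (ν-size X)) (cong ν hX)) ⟩
    ν (suc k) * S + - S * ν (suc k)
      ≡⟨ lem2 (ν (suc k)) S ⟩
    0ℚ ∎)
    where
    open ≡-Reasoning
    lem : ∀ x k y s → x * (k * y - s) ≡ k * (x * y) + - s * x
    lem = solve-∀ ring
    lem2 : ∀ k s → k * s + - s * k ≡ 0ℚ
    lem2 = solve-∀ ring

Σ-ind-const : ∀ {n} (X : VSet n) c → Σ n (λ i → ind X i * c) ≡ ν (size X) * c
Σ-ind-const {n} X c = trans (Σ-cong n (λ i → *-comm (ind X i) c))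
  (trans (Σ-* n c (ind X)) (trans (*-comm c _) (cong (_* c) (≡-sym (ν-size X)))))

module _ {n} (X : VSet n) (f : Fun n) where
  private
    weighted : ∀ {g : Fun n} → (∀ {v} → v ∈ X → f v ≤ g v) → ∀ i → ind X i * f i ≤ ind X i * g i
    weighted {g} h i with X i in eq
    ... | true  = subst₂ _≤_ (≡-sym (*-identityˡ (f i))) (≡-sym (*-identityˡ (g i))) (h eq)
    ... | false = ≤-reflexive (trans (*-zeroˡ (f i)) (≡-sym (*-zeroˡ (g i))))

  Σ-ind-≤ : ∀ {c} → (∀ {v} → v ∈ X → f v ≤ c) → Σ n (λ i → ind X i * f i) ≤ ν (size X) * c
  Σ-ind-≤ {c} h = subst (Σ n (λ i → ind X i * f i) ≤_) (Σ-ind-const X c) (Σ-mono n (weighted h))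

  member≤Σ : (∀ i → 0ℚ ≤ ind X i * f i) → ∀ {v} → v ∈ X → f v ≤ Σ n (λ i → ind X i * f i)
  member≤Σ h {v} v∈X = subst (_≤ Σ n (λ i → ind X i * f i)) (trans (cong (λ b → bit b * f v) v∈X) (*-identityˡ (f v))) (term≤Σ n h v)

0≤ind* : ∀ {n} (X : VSet n) (f : Fun n) → (∀ {v} → v ∈ X → 0ℚ ≤ f v) → ∀ i → 0ℚ ≤ ind X i * f i
0≤ind* X f h i with X i in eq
... | true  = subst (0ℚ ≤_) (≡-sym (*-identityˡ (f i))) (h eq)
... | false = ≤-reflexive (≡-sym (*-zeroˡ (f i)))

ind-mono : ∀ {n} (X Y : VSet n) → X ⊆ Y → ∀ i → ind X i ≤ ind Y i
ind-mono X Y X⊆Y i with X i in eq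
... | true  = ≤-reflexive (≡-sym (cong bit (X⊆Y eq)))
... | false = 0≤bit (Y i)

size0⇒ind≡0 : ∀ {n} (X : VSet n) → size X ≡ 0 → ∀ i → ind X i ≡ 0ℚ
size0⇒ind≡0 X h i with X i in eq
... | false = refl
... | true  = contradiction (trans (≡-sym h) (size-∖ X eq)) λ ()

∖-mono : ∀ {n} (X Y : VSet n) v → X ⊆ Y → X ∖ v ⊆ Y ∖ v
∖-mono X Y v X⊆Y {i} h with X i in eq
... | true rewrite X⊆Y eq = h

-- The bilinear form of the weights

module Form {n : ℕ} (G : WGraph n) where

  opaque
    -- `N χ v` is the weighted degree of `v` into `χ`; for disjoint sets, `B χ ψ` is the weight
    -- between them. Both are opaque, so that later goals are stated in these quantities and not in
    -- nested sums.
    N : Fun n → Fun n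
    N χ v = Σ n (λ u → w G v u * χ u)

    B : Fun n → Fun n → ℚ
    B χ ψ = Σ n (λ v → χ v * N ψ v)

    N-cong : ∀ {χ ψ} → (∀ i → χ i ≡ ψ i) → ∀ v → N χ v ≡ N ψ v
    N-cong h v = Σ-cong n (λ u → cong (w G v u *_) (h u))

    B-cong : ∀ {χ χ′ ψ ψ′} → (∀ i → χ i ≡ χ′ i) → (∀ i → ψ i ≡ ψ′ i) → B χ ψ ≡ B χ′ ψ′
    B-cong h k = Σ-cong n (λ v → cong₂ _*_ (h v) (N-cong k v))

    N-⊞ : ∀ χ ψ v → N (χ ⊞ ψ) v ≡ N χ v + N ψ v
    N-⊞ χ ψ v = trans (Σ-cong n (λ u → *-distribˡ-+ (w G v u) (χ u) (ψ u))) (Σ-+ n _ _)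

    N-scale : ∀ c χ v → N (λ i → c * χ i) v ≡ c * N χ v
    N-scale c χ v = trans (Σ-cong n (λ u → swap (w G v u) c (χ u))) (Σ-* n c _)
      where
      swap : ∀ x c y → x * (c * y) ≡ c * (x * y)
      swap = solve-∀ ring

    N-δ : ∀ v u → N (δ v) u ≡ w G u v
    N-δ v u = trans (Σ-cong n (λ i → *-comm (w G u i) (δ v i))) (Σ-δ n v (w G u))

    B-⊞ˡ : ∀ χ ψ φ → B (χ ⊞ ψ) φ ≡ B χ φ + B ψ φ
    B-⊞ˡ χ ψ φ = trans (Σ-cong n (λ v → *-distribʳ-+ (N φ v) (χ v) (ψ v))) (Σ-+ n _ _)

    B-⊞ʳ : ∀ χ ψ φ → B χ (ψ ⊞ φ) ≡ B χ ψ + B χ φ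
    B-⊞ʳ χ ψ φ = trans (Σ-cong n (λ v → trans (cong (χ v *_) (N-⊞ ψ φ v)) (*-distribˡ-+ (χ v) (N ψ v) (N φ v)))) (Σ-+ n _ _)

    B-sym : ∀ χ ψ → B χ ψ ≡ B ψ χ
    B-sym χ ψ = begin
      Σ n (λ v → χ v * N ψ v)
        ≡⟨ Σ-cong n (λ v → ≡-sym (Σ-* n (χ v) _)) ⟩
      Σ n (λ v → Σ n (λ u → χ v * (w G v u * ψ u)))
        ≡⟨ Σ-comm n n _ ⟩
      Σ n (λ u → Σ n (λ v → χ v * (w G v u * ψ u)))
        ≡⟨ Σ-cong n (λ u → Σ-cong n (λ v → trans (cong (λ z → χ v * (z * ψ u)) (sym G v u)) (swap (χ v) (w G u v) (ψ u)))) ⟩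
      Σ n (λ u → Σ n (λ v → ψ u * (w G u v * χ v)))
        ≡⟨ Σ-cong n (λ u → Σ-* n (ψ u) _) ⟩
      Σ n (λ u → ψ u * N χ u) ∎
      where
      open ≡-Reasoning
      swap : ∀ x y z → x * (y * z) ≡ z * (y * x)
      swap = solve-∀ ring

    B-δˡ : ∀ v ψ → B (δ v) ψ ≡ N ψ v
    B-δˡ v ψ = Σ-δ n v (N ψ)

    B-δʳ : ∀ v ψ → B ψ (δ v) ≡ N ψ v
    B-δʳ v ψ = trans (B-sym ψ (δ v)) (B-δˡ v ψ)

    N-mono : ∀ {χ ψ} → (∀ i → χ i ≤ ψ i) → ∀ v → N χ v ≤ N ψ v
    N-mono h v = Σ-mono n (λ u → *-monoˡ-≤-nonNeg (w G v u) {{nonNegative (nonneg G v u)}} (h u))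

    N-𝟘 : ∀ v → N 𝟘 v ≡ 0ℚ
    N-𝟘 v = trans (Σ-cong n (λ u → *-zeroʳ (w G v u))) (Σ-zero n)

    0≤N : ∀ {χ} → (∀ i → 0ℚ ≤ χ i) → ∀ v → 0ℚ ≤ N χ v
    0≤N {χ} h v = subst (_≤ N χ v) (N-𝟘 v) (N-mono h v)

    0≤B : ∀ {χ ψ} → (∀ i → 0ℚ ≤ χ i) → (∀ i → 0ℚ ≤ ψ i) → 0ℚ ≤ B χ ψ
    0≤B h k = Σ-nonneg n (λ v → h v ⊗ 0≤N k v)

    B-𝟘ˡ : ∀ {χ} ψ → (∀ i → χ i ≡ 0ℚ) → B χ ψ ≡ 0ℚ
    B-𝟘ˡ {χ} ψ h = trans (Σ-cong n (λ v → trans (cong (_* N ψ v) (h v)) (*-zeroˡ (N ψ v)))) (Σ-zero n)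

    B-scaleˡ : ∀ c χ ψ → B (λ i → c * χ i) ψ ≡ c * B χ ψ
    B-scaleˡ c χ ψ = trans (Σ-cong n (λ i → *-assoc c (χ i) (N ψ i))) (Σ-* n c _)

    B-def : ∀ χ ψ → B χ ψ ≡ Σ n (λ v → χ v * N ψ v)
    B-def χ ψ = refl

    N-def : ∀ χ v → N χ v ≡ Σ n (λ u → w G v u * χ u)
    N-def χ v = refl

  E : Fun n → ℚ
  E χ = B χ χ

  E-cong : ∀ {χ ψ} → (∀ i → χ i ≡ ψ i) → E χ ≡ E ψ
  E-cong h = B-cong h h

  E-⊞ : ∀ χ ψ → E (χ ⊞ ψ) ≡ E χ + # 2 * B χ ψ + E ψ
  E-⊞ χ ψ = begin
    E (χ ⊞ ψ)                              ≡⟨ B-⊞ˡ χ ψ (χ ⊞ ψ) ⟩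
    B χ (χ ⊞ ψ) + B ψ (χ ⊞ ψ)              ≡⟨ cong₂ _+_ (B-⊞ʳ χ χ ψ) (B-⊞ʳ ψ χ ψ) ⟩
    E χ + B χ ψ + (B ψ χ + E ψ)            ≡⟨ cong (λ z → E χ + B χ ψ + (z + E ψ)) (B-sym ψ χ) ⟩
    E χ + B χ ψ + (B χ ψ + E ψ)            ≡⟨ collect (E χ) (B χ ψ) (E ψ) ⟩
    E χ + # 2 * B χ ψ + E ψ                ∎
    where
    open ≡-Reasoning
    collect : ∀ x y z → x + y + (y + z) ≡ x + # 2 * y + z
    collect = solve-∀ ring

  E-split : ∀ σ χ → E σ ≡ E χ + # 2 * B χ (σ ⊟ χ) + E (σ ⊟ χ)
  E-split σ χ = trans (E-cong (λ i → join (σ i) (χ i))) (E-⊞ χ (σ ⊟ χ))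
    where
    join : ∀ s x → s ≡ x + (s - x)
    join = solve-∀ ring

  -- The quadratic term in `c` is a multiple of `w v v`, which is zero. Insertion, deletion and
  -- recolouring are the cases where `c` is 1, -1 or a difference of deltas.
  E-bump : ∀ c v χ → E (λ i → χ i + c * δ v i) ≡ E χ + # 2 * c * N χ v
  E-bump c v χ = begin
    E (χ ⊞ cδ)                             ≡⟨ E-⊞ χ cδ ⟩
    E χ + # 2 * B χ cδ + B cδ cδ           ≡⟨ cong₂ (λ x y → E χ + # 2 * x + y) (trans (B-sym χ cδ) (B-cδ χ)) (trans (B-cδ cδ) (cong (c *_) self)) ⟩
    E χ + # 2 * (c * N χ v) + c * 0ℚ       ≡⟨ tidy (E χ) c (N χ v) ⟩
    E χ + # 2 * c * N χ v                  ∎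
    where
    open ≡-Reasoning
    cδ : Fun n
    cδ i = c * δ v i
    B-cδ : ∀ ψ → B cδ ψ ≡ c * N ψ v
    B-cδ ψ = trans (B-scaleˡ c (δ v) ψ) (cong (c *_) (B-δˡ v ψ))
    self : N cδ v ≡ 0ℚ
    self = trans (N-scale c (δ v) v) (trans (cong (c *_) (trans (N-δ v v) (loopless G v))) (*-zeroʳ c))
    tidy : ∀ x c y → x + # 2 * (c * y) + c * 0ℚ ≡ x + # 2 * c * y
    tidy = solve-∀ ring

  E-⊞δ : ∀ χ v → E (χ ⊞ δ v) ≡ E χ + # 2 * N χ v
  E-⊞δ χ v = trans (E-cong (λ i → cong (λ z → χ i + z) (≡-sym (*-identityˡ (δ v i)))))
                   (trans (E-bump 1ℚ v χ) (cong (λ z → E χ + z * N χ v) (*-identityʳ (# 2))))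

  E-⊟δ : ∀ χ v → E (χ ⊟ δ v) ≡ E χ - # 2 * N χ v
  E-⊟δ χ v = trans (E-cong (λ i → neg (χ i) (δ v i))) (trans (E-bump (- 1ℚ) v χ) (neg′ (E χ) (N χ v)))
    where
    neg : ∀ x y → x - y ≡ x + - 1ℚ * y
    neg = solve-∀ ring
    neg′ : ∀ x y → x + # 2 * - 1ℚ * y ≡ x - # 2 * y
    neg′ = solve-∀ ring

  N-⊟ : ∀ χ ψ v → N (χ ⊟ ψ) v ≡ N χ v - N ψ v
  N-⊟ χ ψ v = trans (N-cong (λ i → neg (χ i) (ψ i)) v) (trans (N-⊞ χ _ v) (trans (cong (λ z → N χ v + z) (N-scale (- 1ℚ) ψ v)) (≡-sym (neg (N χ v) (N ψ v)))))
    where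
    neg : ∀ x y → x - y ≡ x + - 1ℚ * y
    neg = solve-∀ ring

  -- When `v` changes sides, its edges into `χ` begin to cross and its edges into `ψ` cease to.
  B-removal : ∀ χ ψ v → B (χ ⊟ δ v) (ψ ⊞ δ v) ≡ B χ ψ + N χ v - N ψ v
  B-removal χ ψ v = begin
    B (χ ⊟ δ v) (ψ ⊞ δ v)
      ≡⟨ B-⊞ʳ (χ ⊟ δ v) ψ (δ v) ⟩
    B (χ ⊟ δ v) ψ + B (χ ⊟ δ v) (δ v)
      ≡⟨ cong₂ _+_ (trans (B-sym (χ ⊟ δ v) ψ) (trans (B-⊟ʳ ψ) (cong (_- B ψ (δ v)) (B-sym ψ χ)))) (trans (B-δʳ v (χ ⊟ δ v)) (N-⊟ χ (δ v) v)) ⟩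
    B χ ψ - B ψ (δ v) + (N χ v - N (δ v) v)
      ≡⟨ cong₂ (λ x y → B χ ψ - x + (N χ v - y)) (B-δʳ v ψ) (trans (N-δ v v) (loopless G v)) ⟩
    B χ ψ - N ψ v + (N χ v - 0ℚ)
      ≡⟨ tidy (B χ ψ) (N ψ v) (N χ v) ⟩
    B χ ψ + N χ v - N ψ v ∎
    where
    open ≡-Reasoning
    B-⊟ʳ : ∀ φ → B φ (χ ⊟ δ v) ≡ B φ χ - B φ (δ v)
    B-⊟ʳ φ = begin
      B φ (χ ⊟ δ v)                                  ≡⟨ cancel _ (B φ (δ v)) ⟩
      B φ (χ ⊟ δ v) + B φ (δ v) - B φ (δ v)          ≡⟨ cong (_- B φ (δ v)) (≡-sym (B-⊞ʳ φ (χ ⊟ δ v) (δ v))) ⟩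
      B φ (χ ⊟ δ v ⊞ δ v) - B φ (δ v)                ≡⟨ cong (_- B φ (δ v)) (B-cong {φ} (λ _ → refl) (λ i → ≡-sym (cancel′ (χ i) (δ v i)))) ⟩
      B φ χ - B φ (δ v)                              ∎
      where
      cancel : ∀ x y → x ≡ x + y - y
      cancel = solve-∀ ring
      cancel′ : ∀ x y → x ≡ x - y + y
      cancel′ = solve-∀ ring
    tidy : ∀ x y z → x - y + (z - 0ℚ) ≡ x + z - y
    tidy = solve-∀ ring

  affine : ∀ χ a φ b θ → Σ n (λ i → χ i * (a * N φ i + b * N θ i)) ≡ a * B χ φ + b * B χ θ
  affine χ a φ b θ = begin
    Σ n (λ i → χ i * (a * N φ i + b * N θ i))
      ≡⟨ Σ-cong n (λ i → dist (χ i) a (N φ i) b (N θ i)) ⟩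
    Σ n (λ i → a * (χ i * N φ i) + b * (χ i * N θ i))
      ≡⟨ Σ-+ n (λ i → a * (χ i * N φ i)) (λ i → b * (χ i * N θ i)) ⟩
    Σ n (λ i → a * (χ i * N φ i)) + Σ n (λ i → b * (χ i * N θ i))
      ≡⟨ cong₂ _+_ (Σ-* n a (λ i → χ i * N φ i)) (Σ-* n b (λ i → χ i * N θ i)) ⟩
    a * Σ n (λ i → χ i * N φ i) + b * Σ n (λ i → χ i * N θ i)
      ≡⟨ cong₂ (λ x y → a * x + b * y) (≡-sym (B-def χ φ)) (≡-sym (B-def χ θ)) ⟩
    a * B χ φ + b * B χ θ ∎
    where
    open ≡-Reasoning
    dist : ∀ x a y b z → x * (a * y + b * z) ≡ a * (x * y) + b * (x * z)
    dist = solve-∀ ring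

-- Balanced splits by averaging

module Split {n : ℕ} (G : WGraph n) where
  open Form G

  module Removal (A C : ℚ) (s : ℕ) where

    -- For X of size d + s and a uniformly random s-subset X′ of X, the expectation of
    -- A E(χ′) + C E(ψ + χ - χ′) is P d E(χ) + 2 Q d B(χ, ψ) + C E(ψ). The recursion comes from
    -- conditioning on the first deleted vertex.
    Q P : ℕ → ℚ
    Q zero    = 0ℚ
    Q (suc d) = Q d * (1ℚ - recip (d ℕ.+ s)) + C * recip (d ℕ.+ s)
    P zero    = A
    P (suc d) = P d * (1ℚ - # 2 * recip (d ℕ.+ s)) + # 2 * Q d * recip (d ℕ.+ s)

    -- A vertex is deleted with probability d/(d + s), and `Q d` is `C` times this probability.
    Q-closed : ∀ d → ν (d ℕ.+ s) * Q d ≡ C * ν d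
    Q-closed zero    = trans (*-zeroʳ (ν s)) (≡-sym (trans (cong (C *_) (ν-def 0)) (*-zeroʳ C)))
    Q-closed (suc d) rewrite ν-suc d = step (ν (suc (d ℕ.+ s))) (ν (d ℕ.+ s)) (recip (d ℕ.+ s)) (Q d) (ν d)
                                        (ν-suc (d ℕ.+ s)) (ν-recip (d ℕ.+ s)) (Q-closed d)
      where
      step : ∀ x y r q k → x ≡ y + 1ℚ → x * r ≡ 1ℚ → y * q ≡ C * k →
             x * (q * (1ℚ - r) + C * r) ≡ C * (k + 1ℚ)
      step x y r q k h₁ h₂ h₃ = begin
        x * (q * (1ℚ - r) + C * r)       ≡⟨ e₁ x r q C ⟩
        x * q - x * r * q + C * (x * r)  ≡⟨ cong₂ (λ u v → u * q - v * q + C * v) h₁ h₂ ⟩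
        (y + 1ℚ) * q - 1ℚ * q + C * 1ℚ   ≡⟨ e₂ y q C ⟩
        y * q + C                        ≡⟨ cong (_+ C) h₃ ⟩
        C * k + C                        ≡⟨ e₃ C k ⟩
        C * (k + 1ℚ)                     ∎
        where
        open ≡-Reasoning
        e₁ : ∀ x r q C → x * (q * (1ℚ - r) + C * r) ≡ x * q - x * r * q + C * (x * r)
        e₁ = solve-∀ ring
        e₂ : ∀ y q C → (y + 1ℚ) * q - 1ℚ * q + C * 1ℚ ≡ y * q + C
        e₂ = solve-∀ ring
        e₃ : ∀ C k → C * k + C ≡ C * (k + 1ℚ)
        e₃ = solve-∀ ring

    -- The two terms count ordered pairs of vertices that are both kept and both deleted; a
    -- separated pair contributes nothing. The denominator is cleared because it can vanish.
    P-closed : ∀ d → ν (d ℕ.+ s) * (ν (d ℕ.+ s) - 1ℚ) * P d ≡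
                     A * (ν s * (ν s - 1ℚ)) + C * (ν d * (ν d - 1ℚ))
    P-closed zero    rewrite ν-def 0 = base (ν s) A C
      where
      base : ∀ s A C → s * (s - 1ℚ) * A ≡ A * (s * (s - 1ℚ)) + C * (0ℚ * (0ℚ - 1ℚ))
      base = solve-∀ ring
    P-closed (suc d) rewrite ν-suc d = step (ν (suc (d ℕ.+ s))) (ν (d ℕ.+ s)) (recip (d ℕ.+ s)) (Q d) (P d) (ν d) (A * (ν s * (ν s - 1ℚ)))
                                        (ν-suc (d ℕ.+ s)) (ν-recip (d ℕ.+ s)) (Q-closed d) (P-closed d)
      where
      step : ∀ x y r q p k z → x ≡ y + 1ℚ → x * r ≡ 1ℚ → y * q ≡ C * k →
             y * (y - 1ℚ) * p ≡ z + C * (k * (k - 1ℚ)) →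
             x * (x - 1ℚ) * (p * (1ℚ - # 2 * r) + # 2 * q * r) ≡ z + C * ((k + 1ℚ) * (k + 1ℚ - 1ℚ))
      step x y r q p k z h₁ h₂ h₃ h₄ = begin
        x * (x - 1ℚ) * (p * (1ℚ - # 2 * r) + # 2 * q * r)
          ≡⟨ e₁ x r q p ⟩
        (x - 1ℚ) * (x * p - # 2 * (x * r) * p + # 2 * q * (x * r))
          ≡⟨ cong₂ (λ u v → (u - 1ℚ) * (u * p - # 2 * v * p + # 2 * q * v)) h₁ h₂ ⟩
        (y + 1ℚ - 1ℚ) * ((y + 1ℚ) * p - # 2 * 1ℚ * p + # 2 * q * 1ℚ)
          ≡⟨ e₂ y q p ⟩
        y * (y - 1ℚ) * p + # 2 * (y * q)
          ≡⟨ cong₂ (λ u v → u + # 2 * v) h₄ h₃ ⟩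
        z + C * (k * (k - 1ℚ)) + # 2 * (C * k)
          ≡⟨ e₃ z C k ⟩
        z + C * ((k + 1ℚ) * (k + 1ℚ - 1ℚ)) ∎
        where
        open ≡-Reasoning
        e₁ : ∀ x r q p → x * (x - 1ℚ) * (p * (1ℚ - # 2 * r) + # 2 * q * r) ≡ (x - 1ℚ) * (x * p - # 2 * (x * r) * p + # 2 * q * (x * r))
        e₁ = solve-∀ ring
        e₂ : ∀ y q p → (y + 1ℚ - 1ℚ) * ((y + 1ℚ) * p - # 2 * 1ℚ * p + # 2 * q * 1ℚ) ≡ y * (y - 1ℚ) * p + # 2 * (y * q)
        e₂ = solve-∀ ring
        e₃ : ∀ z C k → z + C * (k * (k - 1ℚ)) + # 2 * (C * k) ≡ z + C * ((k + 1ℚ) * (k + 1ℚ - 1ℚ))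
        e₃ = solve-∀ ring

    -- The method of conditional expectations: some deletion does not raise the expected value. `ψ`
    -- collects the vertices deleted so far.
    descend : ∀ d (X : VSet n) (ψ : Fun n) → size X ≡ d ℕ.+ s →
      ∃ λ X′ → X′ ⊆ X × size X′ ≡ s ×
        A * E (ind X′) + C * E (ψ ⊞ (ind X ⊟ ind X′)) ≤ P d * E (ind X) + # 2 * Q d * B (ind X) ψ + C * E ψ
    descend zero X ψ h = X , (λ z → z) , h , ≤-reflexive (begin
      A * E χ + C * E (ψ ⊞ (χ ⊟ χ))     ≡⟨ cong (λ z → A * E χ + C * z) (E-cong (λ i → void (ψ i) (χ i))) ⟩
      A * E χ + C * E ψ                 ≡⟨ tidy (A * E χ) (B χ ψ) (C * E ψ) ⟩
      A * E χ + # 2 * 0ℚ * B χ ψ + C * E ψ ∎)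
      where
      open ≡-Reasoning
      χ = ind X
      void : ∀ x y → x + (y - y) ≡ x
      void = solve-∀ ring
      tidy : ∀ x y z → x + z ≡ x + # 2 * 0ℚ * y + z
      tidy = solve-∀ ring
    descend (suc d) X ψ h
      -- The averaged function is the part of the next bound that depends on the deleted vertex: its
      -- terms come from `E-⊟δ`, `B-removal` and `E-⊞δ`.
      with average X h (λ v → # 2 * (Q d - P d) * N (ind X) v + # 2 * (C - Q d) * N ψ v)
    ... | v , v∈X , avg
      with descend d (X ∖ v) (ψ ⊞ δ v) (ℕ.suc-injective (trans (≡-sym (size-∖ X v∈X)) h))
    ... | X′ , X′⊆ , size′ , bound = X′ , (λ i∈ → ∖-⊆ X v (X′⊆ i∈)) , size′ ,
      subst (λ z → A * E (ind X′) + C * z ≤ P (suc d) * E χ + # 2 * Q (suc d) * B χ ψ + C * E ψ)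
            (E-cong (λ i → trans (cong (λ z → ψ i + δ v i + (z - ind X′ i)) (ind-∖ X v∈X i)) (regroup (ψ i) (δ v i) (χ i) (ind X′ i))))
            (≤-trans bound
              (combine (E χ) (B χ ψ) (E ψ) (N χ v) (N ψ v) (P d) (Q d) (ν (suc (d ℕ.+ s))) (recip (d ℕ.+ s)) (ν-recip (d ℕ.+ s)) (0<ν-suc (d ℕ.+ s))
                (trans (E-cong (ind-∖ X v∈X)) (E-⊟δ χ v))
                (trans (B-cong {ψ = ψ ⊞ δ v} (ind-∖ X v∈X) (λ _ → refl)) (B-removal χ ψ v))
                (E-⊞δ ψ v)
                (≤-trans avg (≤-reflexive (affine χ (# 2 * (Q d - P d)) χ (# 2 * (C - Q d)) ψ)))))
      where
      χ = ind X
      regroup : ∀ p d x y → p + d + (x - d - y) ≡ p + (x - y)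
      regroup = solve-∀ ring
      combine : ∀ e S y a b p q x r {e′ S′ y′} → x * r ≡ 1ℚ → 0ℚ < x →
        e′ ≡ e - # 2 * a → S′ ≡ S + a - b → y′ ≡ y + # 2 * b →
        x * (# 2 * (q - p) * a + # 2 * (C - q) * b) ≤ # 2 * (q - p) * e + # 2 * (C - q) * S →
        p * e′ + # 2 * q * S′ + C * y′ ≤
        (p * (1ℚ - # 2 * r) + # 2 * q * r) * e + # 2 * (q * (1ℚ - r) + C * r) * S + C * y
      combine e S y a b p q x r xr x>0 refl refl refl hyp =
        cancel-≤ x>0 (slack hyp) (≡-sym (trans (cert x r e S y a b p q C)
          (trans (cong (λ z → z * # 2 * (q - p) * e + z * # 2 * (C - q) * S - x * (# 2 * (q - p) * a + # 2 * (C - q) * b)) xr)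
                 (cert′ x e S a b p q C))))
        where
        cert : ∀ x r e S y a b p q C →
          x * ((p * (1ℚ - # 2 * r) + # 2 * q * r) * e + # 2 * (q * (1ℚ - r) + C * r) * S + C * y
               - (p * (e - # 2 * a) + # 2 * q * (S + a - b) + C * (y + # 2 * b)))
          ≡ (x * r) * # 2 * (q - p) * e + (x * r) * # 2 * (C - q) * S - x * (# 2 * (q - p) * a + # 2 * (C - q) * b)
        cert = solve-∀ ring
        cert′ : ∀ x e S a b p q C →
          1ℚ * # 2 * (q - p) * e + 1ℚ * # 2 * (C - q) * S - x * (# 2 * (q - p) * a + # 2 * (C - q) * b)
          ≡ # 2 * (q - p) * e + # 2 * (C - q) * S - x * (# 2 * (q - p) * a + # 2 * (C - q) * b)
        cert′ = solve-∀ ring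

  open Removal

  biased-split : ∀ A C s d (X : VSet n) → size X ≡ d ℕ.+ s →
    ∃ λ X′ → X′ ⊆ X × size X′ ≡ s ×
      A * E (ind X′) + C * E (ind X ⊟ ind X′) ≤ P A C s d * E (ind X)
  biased-split A C s d X h with descend A C s d X 𝟘 h
  ... | X′ , X′⊆X , size′ , bound = X′ , X′⊆X , size′ ,
    subst₂ _≤_ (cong (λ z → A * E (ind X′) + C * z) (E-cong (λ i → +-identityˡ (ind X i - ind X′ i))))
      (trans (cong₂ (λ y z → P A C s d * E (ind X) + # 2 * Q A C s d * y + C * z) (trans (B-sym (ind X) 𝟘) (B-𝟘ˡ (ind X) (λ _ → refl))) (B-𝟘ˡ 𝟘 (λ _ → refl)))
             (tidy (P A C s d * E (ind X)) (# 2 * Q A C s d) C))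
      bound
    where
    tidy : ∀ x y z → x + y * 0ℚ + z * 0ℚ ≡ x
    tidy = solve-∀ ring

-- Nearly equal halves and thirds of an integer

ν-+ : ∀ a b → ν (a ℕ.+ b) ≡ ν a + ν b
ν-+ zero    b = ≡-sym (trans (cong (_+ ν b) (ν-def 0)) (+-identityˡ (ν b)))
ν-+ (suc a) b = begin
  ν (suc (a ℕ.+ b))      ≡⟨ ν-suc (a ℕ.+ b) ⟩
  ν (a ℕ.+ b) + 1ℚ     ≡⟨ cong (_+ 1ℚ) (ν-+ a b) ⟩
  ν a + ν b + 1ℚ       ≡⟨ shift (ν a) (ν b) ⟩
  ν a + 1ℚ + ν b       ≡⟨ cong (_+ ν b) (≡-sym (ν-suc a)) ⟩
  ν (suc a) + ν b        ∎
  where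
  open ≡-Reasoning
  shift : ∀ x y → x + y + 1ℚ ≡ x + 1ℚ + y
  shift = solve-∀ ring

-- Distance at most 1, squared because it enters the certificates of `halve` and `balanced` in
-- exactly this form.
Adjacent : ℚ → ℚ → Set
Adjacent a b = (a - b) * (a - b) ≤ 1ℚ

adjacent-cong : ∀ a b c d → a - b ≡ c - d → Adjacent a b → Adjacent c d
adjacent-cong a b c d eq = subst (λ z → z * z ≤ 1ℚ) eq

halves : ∀ m → ∃ λ d → ∃ λ s → m ≡ d ℕ.+ s × Adjacent (ν s) (ν d)
halves zero          = 0 , 0 , refl , subst (λ z → Adjacent z z) (≡-sym (ν-def 0)) (0≤# 1)
halves (suc zero)    = 1 , 0 , refl , subst₂ Adjacent (≡-sym (ν-def 0)) (≡-sym (ν-def 1)) ≤-refl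
halves (suc (suc m)) with halves m
... | d , s , eq , adj = suc d , suc s , cong suc (trans (cong suc eq) (≡-sym (ℕ.+-suc d s))) ,
  adjacent-cong (ν s) (ν d) (ν (suc s)) (ν (suc d)) (trans (shift (ν s) (ν d)) (cong₂ _-_ (≡-sym (ν-suc s)) (≡-sym (ν-suc d)))) adj
  where
  shift : ∀ x y → x - y ≡ x + 1ℚ - (y + 1ℚ)
  shift = solve-∀ ring

private
  base : ∀ s d → Adjacent (# 2 * # s) (# d) → Adjacent (# 2 * ν s) (ν d)
  base s d = subst₂ (λ x y → Adjacent (# 2 * x) y) (≡-sym (ν-def s)) (≡-sym (ν-def d))

-- `s` is the integer nearest to a third of the order. The remaining number is displayed as at least
-- 2, as `halve` demands.
thirds : ∀ k → ∃ λ d → ∃ λ s → 3 ℕ.+ k ≡ suc (suc d) ℕ.+ s × Adjacent (# 2 * ν s) (ν (suc (suc d)))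
thirds zero             = 0 , 1 , refl , base 1 2 (0≤# 1)
thirds (suc zero)       = 1 , 1 , refl , base 1 3 ≤-refl
thirds (suc (suc zero)) = 1 , 2 , refl , base 2 3 ≤-refl
thirds (suc (suc (suc k))) with thirds k
... | d , s , eq , adj = suc (suc d) , suc s , cong (λ z → suc (suc z)) (trans (cong suc eq) (≡-sym (ℕ.+-suc (suc (suc d)) s))) ,
  adjacent-cong (# 2 * ν s) (ν (suc (suc d))) (# 2 * ν (suc s)) (ν (suc (suc (suc (suc d)))))
    (trans (shift (ν s) (ν (suc (suc d))))
      (cong₂ (λ x y → # 2 * x - y) (≡-sym (ν-suc s))
        (≡-sym (trans (ν-suc (suc (suc (suc d)))) (cong (_+ 1ℚ) (ν-suc (suc (suc d)))))))) adj
  where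
  shift : ∀ x y → # 2 * x - y ≡ # 2 * (x + 1ℚ) - (y + 1ℚ + 1ℚ)
  shift = solve-∀ ring

size-full : ∀ n → size {n} (λ _ → true) ≡ n
size-full zero    = refl
size-full (suc n) = cong suc (size-full n)

0<-* : ∀ {p q} → 0ℚ < p → 0ℚ < q → 0ℚ < p * q
0<-* {p} {q} h k = subst (_< p * q) (*-zeroʳ p) (*-monoʳ-<-pos p {{positive h}} k)

-- Balanced 3-partitions with a large cut

module Cuts {n : ℕ} (G : WGraph n) where
  open Form G
  open Split G

  inside : VSet n → VSet n → ℚ
  inside Y Z = E (𝟙 ⊟ ind Y) + (E (ind Z) + E (ind Y ⊟ ind Z))

  0≤E-ind : ∀ X → 0ℚ ≤ E (ind X)
  0≤E-ind X = 0≤B (λ i → 0≤bit (X i)) (λ i → 0≤bit (X i))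

  -- For m vertices the factor (m - 1)/(2m) is the exact expectation when m is odd. An even m would
  -- give the smaller (m - 2)/(2(m - 1)); one bound serves both parities.
  halve : ∀ (U : VSet n) {k} → size U ≡ suc (suc k) →
    ∃ λ Z → Z ⊆ U × # 2 * ν (suc (suc k)) * (E (ind Z) + E (ind U ⊟ ind Z)) ≤ ν (suc k) * E (ind U)
  halve U {k} hU =
    let d , s , m≡ , adj = halves (suc (suc k))
        Z , Z⊆U , _ , bound = biased-split 1ℚ 1ℚ s d U (trans hU m≡)
    in Z , Z⊆U ,
      arith (ν (suc (suc k))) (ν (suc k)) (ν d) (ν s) (Removal.P 1ℚ 1ℚ s d) (E (ind Z)) (E (ind U ⊟ ind Z)) (E (ind U))
        (ν-suc (suc k)) (trans (cong ν m≡) (ν-+ d s)) (0<ν-suc k) (0≤ν (suc (suc k))) (0≤E-ind U)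
        (subst (λ z → ν z * (ν z - 1ℚ) * Removal.P 1ℚ 1ℚ s d ≡ 1ℚ * (ν s * (ν s - 1ℚ)) + 1ℚ * (ν d * (ν d - 1ℚ)))
               (≡-sym m≡) (Removal.P-closed 1ℚ 1ℚ s d))
        adj bound
    where
    arith : ∀ m m′ d s p x y u → m ≡ m′ + 1ℚ → m ≡ d + s → 0ℚ < m′ → 0ℚ ≤ m → 0ℚ ≤ u →
      m * (m - 1ℚ) * p ≡ 1ℚ * (s * (s - 1ℚ)) + 1ℚ * (d * (d - 1ℚ)) →
      Adjacent s d → 1ℚ * x + 1ℚ * y ≤ p * u → # 2 * m * (x + y) ≤ m′ * u
    arith m m′ d s p x y u h₁ h₂ m′>0 m≥0 u≥0 hp adj hb = ≤-by
      (2 · (m≥0 ⊗ slack hb) ⊕ slack 2mp≤m′ ⊗ u≥0)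
      (cert m m′ p x y u)
      where
      m′≡ : m′ ≡ d + s - 1ℚ
      m′≡ = trans (drop m′) (cong (_- 1ℚ) (trans (≡-sym h₁) h₂))
        where
        drop : ∀ x → x ≡ x + 1ℚ - 1ℚ
        drop = solve-∀ ring
      2mp≤m′ : # 2 * m * p ≤ m′
      2mp≤m′ = cancel-≤ m′>0 (slack adj) (≡-sym (begin
        m′ * (m′ - # 2 * m * p)         ≡⟨ e₁ m m′ p ⟩
        m′ * m′ - # 2 * (m * (m′ + 1ℚ - 1ℚ) * p)   ≡⟨ cong (λ z → m′ * m′ - # 2 * (m * (z - 1ℚ) * p)) (≡-sym h₁) ⟩
        m′ * m′ - # 2 * (m * (m - 1ℚ) * p)         ≡⟨ cong₂ (λ z y → z * z - # 2 * y) m′≡ hp ⟩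
        (d + s - 1ℚ) * (d + s - 1ℚ) - # 2 * (1ℚ * (s * (s - 1ℚ)) + 1ℚ * (d * (d - 1ℚ))) ≡⟨ e₂ s d ⟩
        1ℚ - (s - d) * (s - d) ∎))
        where
        open ≡-Reasoning
        e₁ : ∀ m m′ p → m′ * (m′ - # 2 * m * p) ≡ m′ * m′ - # 2 * (m * (m′ + 1ℚ - 1ℚ) * p)
        e₁ = solve-∀ ring
        e₂ : ∀ s d → (d + s - 1ℚ) * (d + s - 1ℚ) - # 2 * (1ℚ * (s * (s - 1ℚ)) + 1ℚ * (d * (d - 1ℚ))) ≡ 1ℚ - (s - d) * (s - d)
        e₂ = solve-∀ ring
      cert : ∀ m m′ p x y u → # 2 * (m * (p * u - (1ℚ * x + 1ℚ * y))) + (m′ - # 2 * m * p) * u ≡ m′ * u - # 2 * m * (x + y)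
      cert = solve-∀ ring

  -- The first split is biased by the weights 2m and m - 1, whose ratio is the factor that halving
  -- the other m vertices will produce. The two bounds then add up to a bound on the total inside
  -- weight.
  balanced : 3 ℕ.≤ n → ∃ λ Y → ∃ λ Z → Z ⊆ Y × # 3 * ν n * inside Y Z ≤ (ν n - # 2) * E 𝟙
  balanced 3≤n =
    let d , s , n≡′ , adj = thirds (n ℕ.∸ 3)
        m  = suc (suc d)
        n≡ = trans (≡-sym (ℕ.m+[n∸m]≡n 3≤n)) n≡′
        p  = Removal.P (# 2 * ν m) (ν (suc d)) s m
        X , _ , sizeX , bound = biased-split (# 2 * ν m) (ν (suc d)) s m (λ _ → true) (trans (size-full n) n≡)
        Z , Z⊆ , bound′ = halve (∁ X) (ℕ.+-cancelˡ-≡ s (size (∁ X)) m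
          (trans (cong (ℕ._+ size (∁ X)) (≡-sym sizeX)) (trans (size-∁ X) (trans n≡ (ℕ.+-comm m s)))))
    in ∁ X , Z , Z⊆ ,
      arith (ν n) (ν m) (ν (suc d)) (ν s) p (E (ind X)) (E (ind Z) + E (ind (∁ X) ⊟ ind Z)) (E (ind (∁ X))) (E 𝟙)
        (E-cong (λ i → trans (cong (λ z → 1ℚ - z) (ind-∁ X i)) (dbl (ind X i))))
        (ν-suc (suc d)) (trans (cong ν n≡) (ν-+ m s))
        (subst (λ z → 0ℚ < z - 1ℚ) (≡-sym (trans (cong ν n≡) (ν-suc (suc d ℕ.+ s)))) (subst (0ℚ <_) (drop (ν (suc d ℕ.+ s))) (0<ν-suc (d ℕ.+ s))))
        (0<ν-suc (suc d)) (0≤ν n) (0≤B (λ _ → 0≤# 1) (λ _ → 0≤# 1))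
        (subst (λ z → ν z * (ν z - 1ℚ) * p ≡ # 2 * ν m * (ν s * (ν s - 1ℚ)) + ν (suc d) * (ν m * (ν m - 1ℚ)))
               (≡-sym n≡) (Removal.P-closed (# 2 * ν m) (ν (suc d)) s m))
        adj
        (subst (λ z → # 2 * ν m * E (ind X) + ν (suc d) * z ≤ p * E 𝟙) (E-cong (λ i → ≡-sym (ind-∁ X i))) bound)
        bound′
    where
    drop : ∀ x → x ≡ x + 1ℚ - 1ℚ
    drop = solve-∀ ring
    dbl : ∀ x → 1ℚ - (1ℚ - x) ≡ x
    dbl = solve-∀ ring
    arith : ∀ n m m′ s p x i y t {x′} → x′ ≡ x → m ≡ m′ + 1ℚ → n ≡ m + s → 0ℚ < n - 1ℚ → 0ℚ < m → 0ℚ ≤ n → 0ℚ ≤ t →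
      n * (n - 1ℚ) * p ≡ # 2 * m * (s * (s - 1ℚ)) + m′ * (m * (m - 1ℚ)) →
      Adjacent (# 2 * s) m → # 2 * m * x + m′ * y ≤ p * t → # 2 * m * i ≤ m′ * y →
      # 3 * n * (x′ + i) ≤ (n - # 2) * t
    arith n m m′ s p x i y t refl h₁ h₂ n>1 m>0 n≥0 t≥0 hp adj hb hi =
      cancel-≤ (0<-* (positive⁻¹ (# 2)) m>0)
        (3 · (n≥0 ⊗ (slack hb ⊕ slack hi)) ⊕ slack 3np≤ ⊗ t≥0)
        (cert n m m′ p x i y t)
      where
      3np≤ : # 3 * n * p ≤ # 2 * m * (n - # 2)
      3np≤ = cancel-≤ n>1 (<⇒≤ m>0 ⊗ slack adj) (≡-sym (begin
        (n - 1ℚ) * (# 2 * m * (n - # 2) - # 3 * n * p)   ≡⟨ e₁ n m p ⟩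
        # 2 * m * (n - 1ℚ) * (n - # 2) - # 3 * (n * (n - 1ℚ) * p)   ≡⟨ cong₂ (λ a b → # 2 * m * (a - 1ℚ) * (a - # 2) - # 3 * b) h₂ hp ⟩
        # 2 * m * (m + s - 1ℚ) * (m + s - # 2) - # 3 * (# 2 * m * (s * (s - 1ℚ)) + m′ * (m * (m - 1ℚ)))
          ≡⟨ cong (λ a → # 2 * m * (m + s - 1ℚ) * (m + s - # 2) - # 3 * (# 2 * m * (s * (s - 1ℚ)) + a * (m * (m - 1ℚ)))) (trans (drop m′) (cong (_- 1ℚ) (≡-sym h₁))) ⟩
        # 2 * m * (m + s - 1ℚ) * (m + s - # 2) - # 3 * (# 2 * m * (s * (s - 1ℚ)) + (m - 1ℚ) * (m * (m - 1ℚ)))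
          ≡⟨ e₂ m s ⟩
        m * (1ℚ - (# 2 * s - m) * (# 2 * s - m)) ∎))
        where
        open ≡-Reasoning
        e₁ : ∀ n m p → (n - 1ℚ) * (# 2 * m * (n - # 2) - # 3 * n * p) ≡ # 2 * m * (n - 1ℚ) * (n - # 2) - # 3 * (n * (n - 1ℚ) * p)
        e₁ = solve-∀ ring
        e₂ : ∀ m s → # 2 * m * (m + s - 1ℚ) * (m + s - # 2) - # 3 * (# 2 * m * (s * (s - 1ℚ)) + (m - 1ℚ) * (m * (m - 1ℚ))) ≡ m * (1ℚ - (# 2 * s - m) * (# 2 * s - m))
        e₂ = solve-∀ ring
      cert : ∀ n m m′ p x i y t →
        # 3 * (n * (p * t - (# 2 * m * x + m′ * y) + (m′ * y - # 2 * m * i))) + (# 2 * m * (n - # 2) - # 3 * n * p) * t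
        ≡ # 2 * m * ((n - # 2) * t - # 3 * n * (x + i))
      cert = solve-∀ ring

-- Arithmetic of the moves

module Arithmetic where

  -- Here `e`, `S`, `W` are the weights within `X`, across, and outside; `a` and `y` are the degrees
  -- of the moved vertex into `X` and its complement. The new value of 2E(X) + E(Y) is at most T -
  -- 3e, and `e` is large.
  move-potential : ∀ T D e S W a y → T ≡ e + # 2 * S + W → T + # 2 * D ≤ # 9 * e → y - # 2 * a ≤ S - # 2 * e →
    # 3 * (# 2 * (e - # 2 * a) + (W + # 2 * y)) ≤ # 2 * T - # 2 * D
  move-potential T D e S W a y refl h₁ h₂ = ≤-by (slack h₁ ⊕ 6 · slack h₂) (cert e S W D a y)
    where
    cert : ∀ e S W D a y → let T = e + # 2 * S + W in
      # 9 * e - (T + # 2 * D) + # 6 * (S - # 2 * e - (y - # 2 * a)) ≡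
      # 2 * T - # 2 * D - # 3 * (# 2 * (e - # 2 * a) + (W + # 2 * y))
    cert = solve-∀ ring

  -- Since 3y = (y - 2a) + 2(a + y) ≤ S - 2e + 2D, the new W + 2y is at most T - 5e + 4D/3 once S ≥
  -- 2e is used.
  move-rest : ∀ T D e S W a y → T ≡ e + # 2 * S + W → T + # 2 * D ≤ # 9 * e → y - # 2 * a ≤ S - # 2 * e →
    # 2 * e ≤ S → a + y ≤ D → # 9 * (W + # 2 * y) ≤ # 4 * T + # 2 * D
  move-rest T D e S W a y refl h₁ h₂ h₃ h₄ =
    ≤-by (5 · slack h₁ ⊕ 6 · slack h₂ ⊕ 12 · slack h₃ ⊕ 12 · slack h₄) (cert e S W D a y)
    where
    cert : ∀ e S W D a y → let T = e + # 2 * S + W in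
      # 5 * (# 9 * e - (T + # 2 * D)) + # 6 * (S - # 2 * e - (y - # 2 * a)) + # 12 * (S - # 2 * e) + # 12 * (D - (a + y))
      ≡ # 4 * T + # 2 * D - # 9 * (W + # 2 * y)
    cert = solve-∀ ring

  -- `x` and `k` are the sizes of `X` and of its complement before the move, n = x + k. Averaging,
  -- halving and S ≥ 2e bound 2(k + 1)x times the new inside weight by kxT - K e. The target (n -
  -- 2)T/(3n) then amounts to x T M ≤ 9 n K e.
  K M : ℚ → ℚ → ℚ
  K x k = # 3 * x * (k + 1ℚ) - # 5 * x + # 4
  M x k = # 3 * (x + k) * (k + 1ℚ) - # 9 * (x + k) + # 12 * (k + 1ℚ)

  0≤K : ∀ x k → # 2 ≤ x → 1ℚ ≤ k → 0ℚ ≤ K x k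
  0≤K x k hx hk = ≤-by (3 · (x≥0 ⊗ slack hk) ⊕ x≥0 ⊕ 0≤# 4) (cert x k)
    where
    x≥0 = ≤-trans (0≤# 2) hx
    cert : ∀ x k → # 3 * (x * (k - 1ℚ)) + x + # 4 ≡ # 3 * x * (k + 1ℚ) - # 5 * x + # 4 - 0ℚ
    cert = solve-∀ ring

  -- The two bounds on D (by the average degree, and by the degrees inside X) each suffice on
  -- one side of 3x = n + 2, because of the factorisations in the two certificates.
  core : ∀ x k T D → # 2 ≤ x → 1ℚ ≤ k → 0ℚ ≤ T → T ≤ (x + k) * D → T + # 2 * D ≤ # 3 * x * D →
    x * T * M x k ≤ (x + k) * K x k * (T + # 2 * D)
  core x k T D hx hk hT h₁ h₂ = case ≤-total (x + k + # 2) (# 3 * x) of λ where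
      (inj₁ h) → ≤-by (2 · (0≤K x k hx hk ⊗ slack h₁) ⊕ 2 · (hT ⊗ (slack h ⊗ slack hx))) (cert₁ x k T D)
      (inj₂ h) → cancel-≤ {r = # 3 * x - # 2} (<-≤-trans (positive⁻¹ (# 4)) (≤-by (3 · slack hx) (cert₀ x)))
                   (2 · (n≥0 ⊗ 0≤K x k hx hk ⊗ slack h₂) ⊕ 6 · (x≥0 ⊗ hT ⊗ (slack h ⊗ (slack h ⊕ x≥0))))
                   (cert₂ x k T D)
    where
    x≥0 = ≤-trans (0≤# 2) hx
    n≥0 = x≥0 ⊕ ≤-trans (0≤# 1) hk
    cert₀ : ∀ x → # 3 * (x - # 2) ≡ # 3 * x - # 2 - # 4
    cert₀ = solve-∀ ring
    cert₁ : ∀ x k T D → let K = # 3 * x * (k + 1ℚ) - # 5 * x + # 4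
                            M = # 3 * (x + k) * (k + 1ℚ) - # 9 * (x + k) + # 12 * (k + 1ℚ) in
      # 2 * (K * ((x + k) * D - T)) + # 2 * (T * ((# 3 * x - (x + k + # 2)) * (x - # 2)))
      ≡ (x + k) * K * (T + # 2 * D) - x * T * M
    cert₁ = solve-∀ ring
    cert₂ : ∀ x k T D → let K = # 3 * x * (k + 1ℚ) - # 5 * x + # 4
                            M = # 3 * (x + k) * (k + 1ℚ) - # 9 * (x + k) + # 12 * (k + 1ℚ) in
      # 2 * ((x + k) * K * (# 3 * x * D - (T + # 2 * D)))
        + # 6 * (x * T * ((x + k + # 2 - # 3 * x) * (x + k + # 2 - # 3 * x + x)))
      ≡ (# 3 * x - # 2) * ((x + k) * K * (T + # 2 * D) - x * T * M)
    cert₂ = solve-∀ ring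

  -- This is where the moved vertex has to be chosen by averaging (`h₅`); `h₆` is the halving of the
  -- k + 1 vertices outside after the move.
  move-cut : ∀ n x k T D e S W a y I → n ≡ x + k → T ≡ e + # 2 * S + W → # 2 ≤ x → 1ℚ ≤ k → 0ℚ ≤ T →
    T ≤ n * D → e + S ≤ x * D → T + # 2 * D ≤ # 9 * e → # 2 * e ≤ S →
    x * (k * y + - (# 2 * (k + 1ℚ)) * a) ≤ k * S + - (# 2 * (k + 1ℚ)) * e →
    # 2 * (k + 1ℚ) * I ≤ k * (W + # 2 * y) →
    # 3 * n * (e - # 2 * a + I) ≤ (n - # 2) * T
  move-cut n x k T D e S W a y I refl refl hx hk hT h₁ h₂ h₃ h₄ h₅ h₆ =
    cancel-≤ {r = # 6 * ((k + 1ℚ) * x)} (0<-* (positive⁻¹ (# 6)) (0<-* m>0 (<-≤-trans (positive⁻¹ (# 2)) hx)))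
      -- The degree bound for `core` is the chain T + 2D ≤ 9e ≤ 3(e + S) ≤ 3xD.
      (slack (core x k _ D hx hk hT h₁ (≤-by (slack h₃ ⊕ 3 · slack h₄ ⊕ 3 · slack h₂) (deg x k D e S W)))
        ⊕ 18 · (n≥0 ⊗ slack h₅) ⊕ 9 · (n≥0 ⊗ x≥0 ⊗ slack h₆)
        ⊕ n≥0 ⊗ 0≤K x k hx hk ⊗ slack h₃
        ⊕ 18 · (n≥0 ⊗ (k≥0 ⊗ (slack hx ⊕ 0≤# 1) ⊗ slack h₄)))
      (cert x k D e S W a y I)
    where
    x≥0 = ≤-trans (0≤# 2) hx
    k≥0 = ≤-trans (0≤# 1) hk
    n≥0 = x≥0 ⊕ k≥0
    m>0 : 0ℚ < k + 1ℚ
    m>0 = <-≤-trans (positive⁻¹ 1ℚ) (≤-by (slack hk ⊕ 0≤# 1) (k+1 k))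
      where
      k+1 : ∀ k → k - 1ℚ + 1ℚ ≡ k + 1ℚ - 1ℚ
      k+1 = solve-∀ ring
    deg : ∀ x k D e S W → let T = e + # 2 * S + W in
      # 9 * e - (T + # 2 * D) + # 3 * (S - # 2 * e) + # 3 * (x * D - (e + S)) ≡ # 3 * x * D - (T + # 2 * D)
    deg = solve-∀ ring
    cert : ∀ x k D e S W a y I → let T = e + # 2 * S + W
                                     n = x + k
                                     K = # 3 * x * (k + 1ℚ) - # 5 * x + # 4
                                     M = # 3 * (x + k) * (k + 1ℚ) - # 9 * (x + k) + # 12 * (k + 1ℚ) in
      n * K * (T + # 2 * D) - x * T * M
        + # 18 * (n * (k * S + - (# 2 * (k + 1ℚ)) * e - x * (k * y + - (# 2 * (k + 1ℚ)) * a)))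
        + # 9 * (n * x * (k * (W + # 2 * y) - # 2 * (k + 1ℚ) * I))
        + n * K * (# 9 * e - (T + # 2 * D))
        + # 18 * (n * (k * (x - # 2 + 1ℚ) * (S - # 2 * e)))
      ≡ # 6 * ((k + 1ℚ) * x) * ((n - # 2) * T - # 3 * n * (e - # 2 * a + I))
    cert = solve-∀ ring

  -- By the gain bound the new inside weight is at most e₁ + W - 2e₂. Half of 2e₁ + W is at most (T
  -- - D)/3, half of W at most (2T + D)/9, and 2e₂ is at least 2(T + 2D)/9.
  transfer-cut : ∀ T D e₁ W e₂ S e₃ a b → W ≡ e₂ + # 2 * S + e₃ → # 3 * (# 2 * e₁ + W) ≤ # 2 * T - # 2 * D →
    # 9 * W ≤ # 4 * T + # 2 * D → T + # 2 * D ≤ # 9 * e₂ → b - a ≤ S - e₂ →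
    # 3 * (e₁ + (e₂ - # 2 * a + (e₃ + # 2 * b))) ≤ T - # 2 * D
  transfer-cut T D e₁ W e₂ S e₃ a b refl h₁ h₂ h₃ h₄ =
    cancel-≤ {r = # 6} (positive⁻¹ (# 6)) (3 · slack h₁ ⊕ slack h₂ ⊕ 4 · slack h₃ ⊕ 36 · slack h₄) (cert T D e₁ e₂ S e₃ a b)
    where
    cert : ∀ T D e₁ e₂ S e₃ a b → let W = e₂ + # 2 * S + e₃ in
      # 3 * (# 2 * T - # 2 * D - # 3 * (# 2 * e₁ + W)) + (# 4 * T + # 2 * D - # 9 * W)
        + # 4 * (# 9 * e₂ - (T + # 2 * D)) + # 36 * (S - e₂ - (b - a))
      ≡ # 6 * (T - # 2 * D - # 3 * (e₁ + (e₂ - # 2 * a + (e₃ + # 2 * b))))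
    cert = solve-∀ ring

  -- The margin 2D covers the 2T/n that (i) asks for.
  cut-of-max-degree : ∀ n T D I → 0ℚ ≤ n → T ≤ n * D → # 3 * I ≤ T - # 2 * D → # 3 * n * I ≤ (n - # 2) * T
  cut-of-max-degree n T D I hn h₁ h₂ = ≤-by (hn ⊗ slack h₂ ⊕ 2 · slack h₁) (cert n T D I)
    where
    cert : ∀ n T D I → n * (T - # 2 * D - # 3 * I) + # 2 * (n * D - T) ≡ (n - # 2) * T - # 3 * n * I
    cert = solve-∀ ring

  -- a, b, c are the weights from u to Z, to Y ∖ Z and to X. When moving u to Y ∖ Z makes that half
  -- too heavy (h₇), there is room for u in X.
  module Blocked (T D e₁ W e₂ S e₃ a b c : ℚ) (W≡ : W ≡ e₂ + # 2 * S + e₃)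
    (h₁ : # 3 * (# 2 * e₁ + W) ≤ # 2 * T - # 2 * D) (h₂ : # 9 * W ≤ # 4 * T + # 2 * D)
    (h₃ : T + # 2 * D ≤ # 9 * e₂) (h₄ : b - a ≤ S - e₂) (h₅ : e₂ ≤ S) (h₆ : a + b + c ≤ D)
    (h₇ : T + # 2 * D ≤ # 9 * (e₃ + # 2 * b)) where

    -- Put q = S - e₂, so W = 3e₂ + 2q + e₃. The lower bounds on e₂ and e₃ + 2b against the upper
    -- bound on W force b - q ≥ D/3. Then a and b are both at least D/3, which leaves c ≤ D/3.
    c≤ : c ≤ b - (S - e₂)
    c≤ = cancel-≤ {r = # 6} (positive⁻¹ (# 6))
      (subst (λ W → 0ℚ ≤ # 9 * (e₃ + # 2 * b) - (T + # 2 * D) + # 3 * (# 9 * e₂ - (T + # 2 * D)) + (# 4 * T + # 2 * D - # 9 * W)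
                         + # 6 * (D - (a + b + c)) + # 6 * (S - e₂ - (b - a)) + # 6 * (S - e₂)) W≡
        (slack h₇ ⊕ 3 · slack h₃ ⊕ slack h₂ ⊕ 6 · slack h₆ ⊕ 6 · slack h₄ ⊕ 6 · slack h₅))
      (cert T D e₂ S e₃ a b c)
      where
      cert : ∀ T D e₂ S e₃ a b c →
        # 9 * (e₃ + # 2 * b) - (T + # 2 * D) + # 3 * (# 9 * e₂ - (T + # 2 * D)) + (# 4 * T + # 2 * D - # 9 * (e₂ + # 2 * S + e₃))
          + # 6 * (D - (a + b + c)) + # 6 * (S - e₂ - (b - a)) + # 6 * (S - e₂)
        ≡ # 6 * (b - (S - e₂) - c)
      cert = solve-∀ ring

    c≤a : c ≤ a
    c≤a = ≤-by (slack c≤ ⊕ slack h₄) (cert a b c (S - e₂))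
      where
      cert : ∀ a b c q → b - q - c + (q - (b - a)) ≡ a - c
      cert = solve-∀ ring

    -- Returning `u` to `X` changes 2E(X) + E(Y) by 4c - 2(a + b), so the potential does not grow.
    2c≤a+b : # 2 * c ≤ a + b
    2c≤a+b = ≤-by (slack c≤a ⊕ (slack c≤ ⊕ slack h₅)) (cert a b c (S - e₂))
      where
      cert : ∀ a b c q → a - c + (b - q - c + q) ≡ a + b - # 2 * c
      cert = solve-∀ ring

    -- With q = S - e₂, the overload gives W ≥ 4(T + 2D)/9 - 2(b - q). The potential bound turns
    -- this into e₁ ≤ (T - 7D)/9 + (b - q), and (b - q) + 2c ≤ a + b + c ≤ D.
    room : # 9 * (e₁ + # 2 * c) ≤ T + # 2 * D
    room = cancel-≤ {r = # 2} (positive⁻¹ (# 2))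
      (subst (λ W → 0ℚ ≤ # 9 * (e₃ + # 2 * b) - (T + # 2 * D) + # 3 * (# 9 * e₂ - (T + # 2 * D))
                         + # 3 * (# 2 * T - # 2 * D - # 3 * (# 2 * e₁ + W))
                         + # 18 * (D - (a + b + c)) + # 18 * (S - e₂ - (b - a)) + # 18 * (S - e₂) + # 18 * (b - (S - e₂) - c)) W≡
        (slack h₇ ⊕ 3 · slack h₃ ⊕ 3 · slack h₁ ⊕ 18 · slack h₆ ⊕ 18 · slack h₄ ⊕ 18 · slack h₅ ⊕ 18 · slack c≤))
      (cert T D e₁ e₂ S e₃ a b c)
      where
      cert : ∀ T D e₁ e₂ S e₃ a b c →
        # 9 * (e₃ + # 2 * b) - (T + # 2 * D) + # 3 * (# 9 * e₂ - (T + # 2 * D))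
          + # 3 * (# 2 * T - # 2 * D - # 3 * (# 2 * e₁ + (e₂ + # 2 * S + e₃)))
          + # 18 * (D - (a + b + c)) + # 18 * (S - e₂ - (b - a)) + # 18 * (S - e₂) + # 18 * (b - (S - e₂) - c)
        ≡ # 2 * (T + # 2 * D - # 9 * (e₁ + # 2 * c))
      cert = solve-∀ ring

-- Minimisers over finite function spaces

HasMin : Set → Set
HasMin A = (F : A → ℚ) → ∃ λ a → ∀ b → F a ≤ F b

Bool-hasMin : HasMin Bool
Bool-hasMin F = case ≤-total (F true) (F false) of λ where
  (inj₁ h) → true  , λ { true → ≤-refl ; false → h }
  (inj₂ h) → false , λ { true → h ; false → ≤-refl }

Fin-hasMin : ∀ k → HasMin (Fin (suc k))
Fin-hasMin zero    F = zero , λ { zero → ≤-refl }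
Fin-hasMin (suc k) F =
  let a , a-min = Fin-hasMin k (F ∘ suc)
  in case ≤-total (F zero) (F (suc a)) of λ where
    (inj₁ h) → zero  , λ { zero → ≤-refl ; (suc b) → ≤-trans h (a-min b) }
    (inj₂ h) → suc a , λ { zero → h ; (suc b) → a-min b }

-- Minimise over the tails for each head, then over the heads. `F` must respect pointwise equality,
-- because a function agrees only pointwise with the one rebuilt from its head and tail.
function-hasMin : ∀ {A : Set} → HasMin A → ∀ n (F : (Fin n → A) → ℚ) →
  (∀ {f g} → (∀ i → f i ≡ g i) → F f ≡ F g) → ∃ λ f → ∀ g → F f ≤ F g
function-hasMin         A-min zero    F F-cong = (λ ()) , λ g → ≤-reflexive (F-cong (λ ()))
function-hasMin {A = A} A-min (suc n) F F-cong =
  let a , a-min = A-min (λ a → F (a ∷ proj₁ (tail-min a)))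
  in a ∷ proj₁ (tail-min a) , λ g →
    ≤-trans (a-min (g zero)) (≤-trans (proj₂ (tail-min (g zero)) (g ∘ suc)) (≤-reflexive (F-cong (λ { zero → refl ; (suc i) → refl }))))
  where
  tail-min : ∀ a → ∃ λ f → ∀ g → F (a ∷ f) ≤ F (a ∷ g)
  tail-min a = function-hasMin A-min n (λ f → F (a ∷ f)) (λ h → F-cong (λ { zero → refl ; (suc i) → h i }))

infixl 7 _∩_
_∩_ : ∀ {n} → VSet n → VSet n → VSet n
(X ∩ Y) i = X i ∧ Y i

∩-⊆ʳ : ∀ {n} (X Y : VSet n) → X ∩ Y ⊆ Y
∩-⊆ʳ X Y {i} h with X i
... | true = h

∩-absorb : ∀ {n} (X Y : VSet n) → X ⊆ Y → ∀ i → (X ∩ Y) i ≡ X i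
∩-absorb X Y X⊆Y i with X i in eq
... | true  = X⊆Y eq
... | false = refl

ind-∁∩ : ∀ {n} (Z Y : VSet n) → Z ⊆ Y → ∀ i → ind (∁ Z ∩ Y) i ≡ (ind Y ⊟ ind Z) i
ind-∁∩ Z Y Z⊆Y i with Z i in eq
... | true rewrite Z⊆Y eq = refl
... | false = ≡-sym (drop (ind Y i))
  where
  drop : ∀ x → x - 0ℚ ≡ x
  drop = solve-∀ ring

-- From a too heavy part to an admissible set

module Peeling {n : ℕ} (G : WGraph n) (D : ℚ) (0≤D : 0ℚ ≤ D) (degree≤D : ∀ v → Form.N G 𝟙 v ≤ D) where
  open Form G
  open Split G
  open Cuts G
  open Arithmetic

  T τ : ℚ
  T = E 𝟙
  τ = T + # 2 * D

  Light : Fun n → Set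
  Light χ = # 9 * E χ ≤ τ

  Heavy : Fun n → Set
  Heavy χ = τ < # 9 * E χ

  LargeCut : VSet n → VSet n → Set
  LargeCut Y Z = # 3 * ν n * inside Y Z ≤ (ν n - # 2) * T

  0≤T : 0ℚ ≤ T
  0≤T = 0≤B (λ _ → 0≤# 1) (λ _ → 0≤# 1)

  T≤nD : T ≤ ν n * D
  T≤nD = subst₂ _≤_ (≡-sym (B-def 𝟙 𝟙)) (Σ-const n D)
    (Σ-mono n (λ v → subst (_≤ D) (≡-sym (*-identityˡ (N 𝟙 v))) (degree≤D v)))

  heavy⇒positive : ∀ χ → Heavy χ → 0ℚ < E χ
  heavy⇒positive χ h = *-cancelˡ-<-nonNeg (# 9) (≤-<-trans (0≤T ⊕ 2 · 0≤D) h)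

  Shrunk : VSet n → Set
  Shrunk X = ∃ λ X′ → X′ ⊆ X × Heavy (ind X′) × (∀ {v} → v ∈ X′ → Light (ind (X′ ∖ v)))

  shrink : ∀ k (X : VSet n) → size X ≡ k → Heavy (ind X) → Shrunk X
  shrink k X sizeX heavy = decide k sizeX (any? (λ v → ∈? X v ×-dec (τ ℚ.<? # 9 * E (ind (X ∖ v)))))
    where
    decide : ∀ k → size X ≡ k → Dec (∃ λ v → v ∈ X × Heavy (ind (X ∖ v))) → Shrunk X
    decide k       _     (no ¬p) = X , (λ v∈X → v∈X) , heavy , λ {v} v∈X → ≮⇒≥ (λ h → ¬p (v , v∈X , h))
    decide zero    sizeX (yes (v , v∈X , _)) = contradiction (trans (≡-sym sizeX) (size-∖ X v∈X)) λ ()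
    decide (suc k) sizeX (yes (v , v∈X , heavy′)) =
      let X′ , X′⊆ , rest = shrink k (X ∖ v) (ℕ.suc-injective (trans (≡-sym (size-∖ X v∈X)) sizeX)) heavy′
      in X′ , (λ u∈ → ∖-⊆ X v (X′⊆ u∈)) , rest

  -- The stored `Z` is a witness for (i) alone. An optimal split of `Y` has at most its inside
  -- weight and so inherits `largeCut`.
  record Admissible (Y : VSet n) : Set where
    field
      light     : Light (𝟙 ⊟ ind Y)
      potential : # 3 * (# 2 * E (𝟙 ⊟ ind Y) + E (ind Y)) ≤ # 2 * T - # 2 * D
      rest      : # 9 * E (ind Y) ≤ # 4 * T + # 2 * D
      Z         : VSet n
      Z⊆Y       : Z ⊆ Y
      largeCut  : LargeCut Y Z

  open Admissible

  N-split : ∀ σ χ v → N σ v ≡ N χ v + N (σ ⊟ χ) v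
  N-split σ χ v = trans (N-cong (λ i → join (σ i) (χ i)) v) (N-⊞ χ (σ ⊟ χ) v)
    where
    join : ∀ s x → s ≡ x + (s - x)
    join = solve-∀ ring

  E-∖ : ∀ X {v} → v ∈ X → E (ind (X ∖ v)) ≡ E (ind X) - # 2 * N (ind X) v
  E-∖ X {v} v∈X = trans (E-cong (ind-∖ X v∈X)) (E-⊟δ (ind X) v)

  E-co∖ : ∀ σ X {v} → v ∈ X → E (σ ⊟ ind (X ∖ v)) ≡ E (σ ⊟ ind X) + # 2 * N (σ ⊟ ind X) v
  E-co∖ σ X {v} v∈X = trans (E-cong (λ i → trans (cong (λ z → σ i - z) (ind-∖ X v∈X i)) (regroup (σ i) (ind X i) (δ v i)))) (E-⊞δ (σ ⊟ ind X) v)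
    where
    regroup : ∀ s x d → s - (x - d) ≡ s - x + d
    regroup = solve-∀ ring

  N-⊆ : ∀ {X X′} → X′ ⊆ X → ∀ v → N (ind X′) v ≤ N (ind X) v
  N-⊆ {X} {X′} X′⊆X = N-mono (ind-mono X′ X X′⊆X)

  heavy⇒nonempty : ∀ X → Heavy (ind X) → ∃ λ k → size X ≡ suc k
  heavy⇒nonempty X heavy = go (size X) refl
    where
    go : ∀ k → size X ≡ k → ∃ λ k → size X ≡ suc k
    go (suc k) eq = k , eq
    go zero    eq = contradiction (B-𝟘ˡ (ind X) (size0⇒ind≡0 X eq)) (λ E≡0 → <-irrefl (≡-sym E≡0) (heavy⇒positive (ind X) heavy))

  module Peel (X : VSet n) (heavy : Heavy (ind X)) (minimal : ∀ {v} → v ∈ X → Light (ind (X ∖ v)))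
              (local : ∀ {v} → v ∈ X → # 3 * N (ind X) v ≤ N 𝟙 v) where
    χ ψ : Fun n
    χ = ind X
    ψ = 𝟙 ⊟ χ

    e S W x : ℚ
    e = E χ
    S = B χ ψ
    W = E ψ
    x = ν (size X)

    -- Half the increase of 2E(X) + E(Y) when `v` leaves `X`.
    gain : Fun n
    gain v = 1ℚ * N ψ v + - # 2 * N χ v

    gain≥0 : ∀ i → 0ℚ ≤ ind X i * gain i
    gain≥0 = 0≤ind* X gain (λ {v} v∈X → ≤-by (slack (subst (# 3 * N χ v ≤_) (N-split 𝟙 χ v) (local v∈X))) (cert (N χ v) (N ψ v)))
      where
      cert : ∀ a y → a + y - # 3 * a ≡ 1ℚ * y + - # 2 * a - 0ℚ
      cert = solve-∀ ring

    gain-total : Σ n (λ i → ind X i * gain i) ≡ S - # 2 * e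
    gain-total = trans (affine χ 1ℚ ψ (- # 2) χ) (cert S e)
      where
      cert : ∀ S e → 1ℚ * S + - # 2 * e ≡ S - # 2 * e
      cert = solve-∀ ring

    2e≤S : # 2 * e ≤ S
    2e≤S = ≤-by (Σ-nonneg n gain≥0) gain-total

    -- All gains over `X` are nonnegative, so each is at most their total.
    gain≤ : ∀ {v} → v ∈ X → N ψ v - # 2 * N χ v ≤ S - # 2 * e
    gain≤ {v} v∈X = subst₂ _≤_ (cert (N ψ v) (N χ v)) gain-total (member≤Σ X gain gain≥0 v∈X)
      where
      cert : ∀ y a → 1ℚ * y + - # 2 * a ≡ y - # 2 * a
      cert = solve-∀ ring

    e+S≤xD : e + S ≤ x * D
    e+S≤xD = subst (_≤ x * D) (trans (≡-sym (B-def χ 𝟙)) (trans (B-cong {χ} (λ _ → refl) (λ i → join (χ i))) (B-⊞ʳ χ χ ψ)))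
      (Σ-ind-≤ X (N 𝟙) (λ {v} _ → degree≤D v))
      where
      join : ∀ x → 1ℚ ≡ x + (1ℚ - x)
      join = solve-∀ ring

    e>0 : 0ℚ < e
    e>0 = heavy⇒positive χ heavy

    -- Deleting `v` leaves nonnegative weight, hence 2 `N χ v` ≤ `e`. Summing over `X` gives 2e ≤
    -- xe, and `e` is positive.
    2≤x : # 2 ≤ x
    2≤x = *-cancelʳ-≤-pos e {{positive e>0}} (subst (_≤ x * e) (trans (affine χ (# 2) χ 0ℚ χ) (cert e)) (Σ-ind-≤ X (λ v → # 2 * N χ v + 0ℚ * N χ v)
        (λ {v} v∈X → ≤-by (subst (0ℚ ≤_) (E-∖ X v∈X) (0≤E-ind (X ∖ v))) (cert′ e (N χ v)))))
      where
      cert : ∀ e → # 2 * e + 0ℚ * e ≡ # 2 * e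
      cert = solve-∀ ring
      cert′ : ∀ e a → e - # 2 * a ≡ e - (# 2 * a + 0ℚ * a)
      cert′ = solve-∀ ring

    T≡ : T ≡ e + # 2 * S + W
    T≡ = E-split 𝟙 χ

    -- Weight at least 2e > 0 leaves `X`, so it must have somewhere to go.
    outside : ∃ λ k → size (∁ X) ≡ suc k
    outside = go (size (∁ X)) refl
      where
      go : ∀ k → size (∁ X) ≡ k → ∃ λ k → size (∁ X) ≡ suc k
      go (suc k) eq = k , eq
      go zero    eq = contradiction S≡0 (λ S≡0 → <-irrefl (≡-sym S≡0) (<-≤-trans e>0 (≤-trans (≤-by (<⇒≤ e>0) (cert e)) 2e≤S)))
        where
        S≡0 : S ≡ 0ℚ
        S≡0 = trans (B-sym χ ψ) (B-𝟘ˡ χ (λ i → trans (≡-sym (ind-∁ X i)) (size0⇒ind≡0 (∁ X) eq i)))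
        cert : ∀ e → e ≡ # 2 * e - e
        cert = solve-∀ ring

    admissible : ∃ Admissible
    admissible =
      let k′ , x≡ = heavy⇒nonempty X heavy
          k , k≡ = outside
          -- With r = `suc k` vertices outside, halving `Y` bounds the inside weight by E(X) +
          -- r/(2(r + 1)) E(Y). The averaged function is half the change of 2(r + 1) times this
          -- bound.
          v , v∈X , avg = average X x≡ (λ v → ν (suc k) * N ψ v + - (# 2 * (ν (suc k) + 1ℚ)) * N χ v)
          Y = ∁ (X ∖ v)
          co : ∀ i → (𝟙 ⊟ ind Y) i ≡ ind (X ∖ v) i
          co = λ i → trans (cong (λ z → 1ℚ - z) (ind-∁ (X ∖ v) i)) (dbl (ind (X ∖ v) i))
          E-X : E (𝟙 ⊟ ind Y) ≡ e - # 2 * N χ v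
          E-X = trans (E-cong co) (E-∖ X v∈X)
          E-Y : E (ind Y) ≡ W + # 2 * N ψ v
          E-Y = trans (E-cong (ind-∁ (X ∖ v))) (E-co∖ 𝟙 X v∈X)
          size-Y : size Y ≡ suc (suc k)
          size-Y = ℕ.suc-injective (ℕ.+-cancelˡ-≡ (size (X ∖ v)) _ _
            (trans (ℕ.+-suc (size (X ∖ v)) (size Y)) (trans (cong suc (size-∁ (X ∖ v)))
              (trans (cong suc (≡-sym (size-∁ X))) (trans (cong₂ (λ p q → suc (p ℕ.+ q)) (size-∖ X v∈X) k≡)
                (≡-sym (trans (ℕ.+-suc (size (X ∖ v)) (suc (suc k))) (cong suc (ℕ.+-suc (size (X ∖ v)) (suc k))))))))))
          Z , Z⊆Y , half = halve Y size-Y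
      in Y , record
        { light = subst (λ z → # 9 * z ≤ τ) (≡-sym (E-cong co)) (minimal v∈X)
        ; potential = subst₂ (λ p q → # 3 * (# 2 * p + q) ≤ # 2 * T - # 2 * D) (≡-sym E-X) (≡-sym E-Y)
            (move-potential T D e S W (N χ v) (N ψ v) T≡ (<⇒≤ heavy) (gain≤ v∈X))
        ; rest = subst (λ q → # 9 * q ≤ # 4 * T + # 2 * D) (≡-sym E-Y)
            (move-rest T D e S W (N χ v) (N ψ v) T≡ (<⇒≤ heavy) (gain≤ v∈X) 2e≤S (subst (_≤ D) (N-split 𝟙 χ v) (degree≤D v)))
        ; Z = Z
        ; Z⊆Y = Z⊆Y
        ; largeCut = subst (λ p → # 3 * ν n * (p + (E (ind Z) + E (ind Y ⊟ ind Z))) ≤ (ν n - # 2) * T) (≡-sym E-X)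
            (move-cut (ν n) x (ν (suc k)) T D e S W (N χ v) (N ψ v) (E (ind Z) + E (ind Y ⊟ ind Z))
              (trans (cong ν (trans (≡-sym (size-∁ X)) (cong (size X ℕ.+_) k≡))) (ν-+ (size X) (suc k)))
              T≡ 2≤x (1≤ν-suc k) 0≤T T≤nD e+S≤xD (<⇒≤ heavy) 2e≤S
              (subst₂ _≤_ (cong (λ z → ν z * (ν (suc k) * N ψ v + - (# 2 * (ν (suc k) + 1ℚ)) * N χ v)) (≡-sym x≡))
                (affine χ (ν (suc k)) ψ (- (# 2 * (ν (suc k) + 1ℚ))) χ) avg)
              (subst₂ (λ p q → # 2 * p * (E (ind Z) + E (ind Y ⊟ ind Z)) ≤ ν (suc k) * q) (ν-suc (suc k)) E-Y half))
        }
      where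
      dbl : ∀ x → 1ℚ - (1ℚ - x) ≡ x
      dbl = solve-∀ ring
      1≤ν-suc : ∀ k → 1ℚ ≤ ν (suc k)
      1≤ν-suc k = ≤-by (0≤ν k) (trans (cert (ν k)) (cong (_- 1ℚ) (≡-sym (ν-suc k))))
        where
        cert : ∀ k → k ≡ k + 1ℚ - 1ℚ
        cert = solve-∀ ring

  -- The degree condition passes to the shrunk set: its left side drops and its right side is
  -- unchanged.
  peel : ∀ X → Heavy (ind X) → (∀ {v} → v ∈ X → # 3 * N (ind X) v ≤ N 𝟙 v) → ∃ Admissible
  peel X heavy local =
    let X′ , X′⊆X , heavy′ , minimal = shrink (size X) X refl heavy
    in Peel.admissible X′ heavy′ minimal
         (λ {v} v∈X′ → ≤-trans (*-monoˡ-≤-nonNeg (# 3) (N-⊆ {X} {X′} X′⊆X v)) (local (X′⊆X v∈X′)))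

-- Splitting an admissible set into two light halves

module Balancing {n : ℕ} (G : WGraph n) (D : ℚ) (0≤D : 0ℚ ≤ D) (degree≤D : ∀ v → Form.N G 𝟙 v ≤ D) where
  open Form G
  open Split G
  open Cuts G
  open Arithmetic
  open Peeling G D 0≤D degree≤D
  open Admissible

  record Judicious : Set where
    field
      Y Z      : VSet n
      Z⊆Y      : Z ⊆ Y
      light₁   : Light (𝟙 ⊟ ind Y)
      light₂   : Light (ind Z)
      light₃   : Light (ind Y ⊟ ind Z)
      largeCut : LargeCut Y Z

  splitWeight : VSet n → VSet n → ℚ
  splitWeight Y Z = E (ind Z) + E (ind Y ⊟ ind Z)

  Optimal : VSet n → VSet n → Set
  Optimal Y Z = Z ⊆ Y × (∀ Z′ → Z′ ⊆ Y → splitWeight Y Z ≤ splitWeight Y Z′)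

  splitWeight-cong : ∀ Y {Z Z′} → (∀ i → Z i ≡ Z′ i) → splitWeight Y Z ≡ splitWeight Y Z′
  splitWeight-cong Y h = cong₂ _+_ (E-cong (λ i → cong bit (h i))) (E-cong (λ i → cong (λ b → ind Y i - bit b) (h i)))

  optimum : ∀ Y → ∃ (Optimal Y)
  optimum Y =
    -- Intersecting with `Y` turns the constrained minimum into one over all vertex sets.
    let Z , Z-min = function-hasMin Bool-hasMin n (λ Z → splitWeight Y (Z ∩ Y)) (λ h → splitWeight-cong Y (λ i → cong (_∧ Y i) (h i)))
    in Z ∩ Y , ∩-⊆ʳ Z Y , λ Z′ Z′⊆Y → ≤-trans (Z-min Z′) (≤-reflexive (splitWeight-cong Y (∩-absorb Z′ Y Z′⊆Y)))

  module _ (Y Z : VSet n) (opt : Optimal Y Z) where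
    private
      Z⊆ : Z ⊆ Y
      Z⊆ = proj₁ opt

      co≗ : ∀ i → ind (∁ Z ∩ Y) i ≡ (ind Y ⊟ ind Z) i
      co≗ = ind-∁∩ Z Y Z⊆

    -- The split weight is symmetric in the two halves; `step` can thus be applied to whichever half
    -- is too heavy.
    optimal-co : Optimal Y (∁ Z ∩ Y)
    optimal-co = ∩-⊆ʳ (∁ Z) Y , λ Z′ Z′⊆Y → ≤-trans (≤-reflexive swap) (proj₂ opt Z′ Z′⊆Y)
      where
      dbl : ∀ y z → y - (y - z) ≡ z
      dbl = solve-∀ ring
      swap : splitWeight Y (∁ Z ∩ Y) ≡ splitWeight Y Z
      swap = trans (cong₂ _+_ (E-cong co≗) (E-cong (λ i → trans (cong (λ z → ind Y i - z) (co≗ i)) (dbl (ind Y i) (ind Z i)))))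
                   (+-comm (E (ind Y ⊟ ind Z)) (E (ind Z)))

    optimal-local : ∀ {v} → v ∈ Z → # 2 * N (ind Z) v ≤ N (ind Y) v
    optimal-local {v} v∈Z = cancel-≤ {r = # 2} (positive⁻¹ (# 2))
      (slack (subst₂ (λ p q → splitWeight Y Z ≤ p + q) (E-∖ Z v∈Z) (E-co∖ (ind Y) Z v∈Z)
        (proj₂ opt (Z ∖ v) (λ u∈ → Z⊆ (∖-⊆ Z v u∈)))))
      (trans (cert (E (ind Z)) (E (ind Y ⊟ ind Z)) (N (ind Z) v) (N (ind Y ⊟ ind Z) v))
             (cong (λ z → # 2 * (z - # 2 * N (ind Z) v)) (≡-sym (N-split (ind Y) (ind Z) v))))
      where
      cert : ∀ p q a b → p - # 2 * a + (q + # 2 * b) - (p + q) ≡ # 2 * (a + b - # 2 * a)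
      cert = solve-∀ ring

  module Transfer (Y : VSet n) (adm : Admissible Y) (Z : VSet n) (Z⊆ : Z ⊆ Y) (heavy : Heavy (ind Z))
    (minimal : ∀ {v} → v ∈ Z → Light (ind (Z ∖ v))) (local : ∀ {v} → v ∈ Z → # 2 * N (ind Z) v ≤ N (ind Y) v)
    (u : Fin n) (u∈Z : u ∈ Z) where

    χ υ ζ ρ : Fun n
    υ = ind Y
    χ = 𝟙 ⊟ υ
    ζ = ind Z
    ρ = υ ⊟ ζ

    a b c S : ℚ
    a = N ζ u
    b = N ρ u
    c = N χ u
    S = B ζ ρ

    gain : Fun n
    gain v = 1ℚ * N ρ v + - 1ℚ * N ζ v

    gain≥0 : ∀ i → 0ℚ ≤ ind Z i * gain i
    gain≥0 = 0≤ind* Z gain (λ {v} v∈Z → ≤-by (slack (subst (# 2 * N ζ v ≤_) (N-split υ ζ v) (local v∈Z))) (cert (N ζ v) (N ρ v)))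
      where
      cert : ∀ a b → a + b - # 2 * a ≡ 1ℚ * b + - 1ℚ * a - 0ℚ
      cert = solve-∀ ring

    gain-total : Σ n (λ i → ind Z i * gain i) ≡ S - E ζ
    gain-total = trans (affine ζ 1ℚ ρ (- 1ℚ) ζ) (cert S (E ζ))
      where
      cert : ∀ S e → 1ℚ * S + - 1ℚ * e ≡ S - e
      cert = solve-∀ ring

    e₂≤S : E ζ ≤ S
    e₂≤S = ≤-by (Σ-nonneg n gain≥0) gain-total

    gain≤ : b - a ≤ S - E ζ
    gain≤ = subst₂ _≤_ (cert b a) gain-total (member≤Σ Z gain gain≥0 u∈Z)
      where
      cert : ∀ y a → 1ℚ * y + - 1ℚ * a ≡ y - a
      cert = solve-∀ ring

    degree : a + b + c ≤ D
    degree = subst (_≤ D) (trans (N-split 𝟙 υ u) (cong (_+ c) (N-split υ ζ u))) (degree≤D u)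

    0≤c : 0ℚ ≤ c
    0≤c = 0≤N (λ i → subst (0ℚ ≤_) (ind-∁ Y i) (0≤bit (∁ Y i))) u

    W≡ : E υ ≡ E ζ + # 2 * S + E ρ
    W≡ = E-split υ ζ

    -- Serves both destinations of `u`: `b′` is `b` for the other half of `Y` and `c` for `X`, since
    -- the total depends only on the degree into the receiving part.
    cut : ∀ b′ → b′ - a ≤ S - E ζ → # 3 * ν n * (E χ + (E ζ - # 2 * a + (E ρ + # 2 * b′))) ≤ (ν n - # 2) * T
    cut b′ h = cut-of-max-degree (ν n) T D (E χ + (E ζ - # 2 * a + (E ρ + # 2 * b′))) (0≤ν n) T≤nD
      (transfer-cut T D (E χ) (E υ) (E ζ) S (E ρ) a b′ W≡ (potential adm) (rest adm) (<⇒≤ heavy) h)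

    settle : # 9 * (E ρ + # 2 * b) ≤ τ → Judicious
    settle h = record
      { Y = Y ; Z = Z ∖ u
      ; Z⊆Y = λ v∈ → Z⊆ (∖-⊆ Z u v∈)
      ; light₁ = light adm
      ; light₂ = minimal u∈Z
      ; light₃ = subst (λ z → # 9 * z ≤ τ) (≡-sym (E-co∖ υ Z u∈Z)) h
      ; largeCut = subst₂ (λ p q → # 3 * ν n * (E χ + (p + q)) ≤ (ν n - # 2) * T) (≡-sym (E-∖ Z u∈Z)) (≡-sym (E-co∖ υ Z u∈Z)) (cut b gain≤)
      }

    return : τ < # 9 * (E ρ + # 2 * b) → Admissible (Y ∖ u)
    return h = record
      { light = subst (λ z → # 9 * z ≤ τ) (≡-sym (E-co∖ 𝟙 Y u∈Y)) room
      ; potential = subst₂ (λ p q → # 3 * (# 2 * p + q) ≤ # 2 * T - # 2 * D) (≡-sym (E-co∖ 𝟙 Y u∈Y)) (≡-sym E-Y)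
          (≤-trans (≤-by (6 · slack 2c≤a+b) (cert₁ (E χ) (E υ) a b c)) (potential adm))
      ; rest = subst (λ q → # 9 * q ≤ # 4 * T + # 2 * D) (≡-sym E-Y)
          (≤-trans (≤-by (18 · (slack 2c≤a+b ⊕ 2 · 0≤c)) (cert₂ (E υ) a b c)) (rest adm))
      ; Z = Z ∖ u
      ; Z⊆Y = ∖-mono Z Y u Z⊆
      ; largeCut = subst (λ z → # 3 * ν n * z ≤ (ν n - # 2) * T) inside≡
          -- The gain condition holds as c - a ≤ 0 ≤ S - E ζ.
          (cut c (≤-trans (≤-by (slack c≤a) (cert₃ a c)) (slack e₂≤S)))
      }
      where
      open Blocked T D (E χ) (E υ) (E ζ) S (E ρ) a b c W≡ (potential adm) (rest adm) (<⇒≤ heavy) gain≤ e₂≤S degree (<⇒≤ h)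
      u∈Y : u ∈ Y
      u∈Y = Z⊆ u∈Z
      E-Y : E (ind (Y ∖ u)) ≡ E υ - # 2 * (a + b)
      E-Y = trans (E-∖ Y u∈Y) (cong (λ z → E υ - # 2 * z) (N-split υ ζ u))
      ρ≗ : ∀ i → (ind (Y ∖ u) ⊟ ind (Z ∖ u)) i ≡ ρ i
      ρ≗ i = trans (cong₂ _-_ (ind-∖ Y u∈Y i) (ind-∖ Z u∈Z i)) (cert₀ (ind Y i) (ind Z i) (δ u i))
        where
        cert₀ : ∀ y z d → y - d - (z - d) ≡ y - z
        cert₀ = solve-∀ ring
      inside≡ : E χ + (E ζ - # 2 * a + (E ρ + # 2 * c)) ≡ inside (Y ∖ u) (Z ∖ u)
      inside≡ = trans (regroup (E χ) (E ζ - # 2 * a) (E ρ) c)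
        (≡-sym (cong₂ _+_ (E-co∖ 𝟙 Y u∈Y) (cong₂ _+_ (E-∖ Z u∈Z) (E-cong ρ≗))))
        where
        regroup : ∀ x y z c → x + (y + (z + # 2 * c)) ≡ x + # 2 * c + (y + z)
        regroup = solve-∀ ring
      cert₁ : ∀ x y a b c → # 6 * (a + b - # 2 * c) ≡ # 3 * (# 2 * x + y) - # 3 * (# 2 * (x + # 2 * c) + (y - # 2 * (a + b)))
      cert₁ = solve-∀ ring
      cert₂ : ∀ y a b c → # 18 * (a + b - # 2 * c + # 2 * c) ≡ # 9 * y - # 9 * (y - # 2 * (a + b))
      cert₂ = solve-∀ ring
      cert₃ : ∀ a c → a - c ≡ 0ℚ - (c - a)
      cert₃ = solve-∀ ring

  step : ∀ Y → Admissible Y → ∀ Z → Optimal Y Z → Heavy (ind Z) → Judicious ⊎ (∃ λ u → u ∈ Y × Admissible (Y ∖ u))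
  step Y adm Z opt heavy =
    let Z′ , Z′⊆Z , heavy′ , minimal = shrink (size Z) Z refl heavy
        k , size≡ = heavy⇒nonempty Z′ heavy′
        u , u∈Z′ = size⁺⇒∃ Z′ size≡
        Z′⊆Y : Z′ ⊆ Y
        Z′⊆Y = λ v∈ → proj₁ opt (Z′⊆Z v∈)
        module Move = Transfer Y adm Z′ Z′⊆Y heavy′ minimal
          (λ {v} v∈Z′ → ≤-trans (*-monoˡ-≤-nonNeg (# 2) (N-⊆ {Z} {Z′} Z′⊆Z v)) (optimal-local Y Z opt (Z′⊆Z v∈Z′))) u u∈Z′
    in decide (# 9 * (E (ind Y ⊟ ind Z′) + # 2 * N (ind Y ⊟ ind Z′) u)) Move.settle (λ h → u , Z′⊆Y u∈Z′ , Move.return h)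
    where
    decide : ∀ p {R : Set} → (p ≤ τ → Judicious) → (τ < p → R) → Judicious ⊎ R
    decide p f g with p ≤? τ
    ... | yes h = inj₁ (f h)
    ... | no h  = inj₂ (g (≰⇒> h))

  descend : ∀ k Y → size Y ≡ k → Admissible Y → Judicious
  descend k Y size≡ adm = decide (# 9 * E (ind Z₀) ≤? τ) (# 9 * E (ind Y ⊟ ind Z₀) ≤? τ)
    where
    Z₀ = proj₁ (optimum Y)
    opt : Optimal Y Z₀
    opt = proj₂ (optimum Y)
    continue : ∀ k → size Y ≡ k → Judicious ⊎ (∃ λ u → u ∈ Y × Admissible (Y ∖ u)) → Judicious
    continue k       _     (inj₁ j) = j
    continue zero    size≡ (inj₂ (u , u∈Y , adm′)) = contradiction (trans (≡-sym size≡) (size-∖ Y u∈Y)) λ ()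
    continue (suc k) size≡ (inj₂ (u , u∈Y , adm′)) = descend k (Y ∖ u) (ℕ.suc-injective (trans (≡-sym (size-∖ Y u∈Y)) size≡)) adm′
    decide : Dec (Light (ind Z₀)) → Dec (Light (ind Y ⊟ ind Z₀)) → Judicious
    decide (no ¬l) _ = continue k size≡ (step Y adm Z₀ opt (≰⇒> ¬l))
    decide (yes l) (no ¬l) = continue k size≡ (step Y adm (∁ Z₀ ∩ Y) (optimal-co Y Z₀ opt)
      (subst (λ z → τ < # 9 * z) (≡-sym (E-cong (ind-∁∩ Z₀ Y (proj₁ opt)))) (≰⇒> ¬l)))
    decide (yes l₂) (yes l₃) = record
      { Y = Y ; Z = Z₀ ; Z⊆Y = proj₁ opt ; light₁ = light adm ; light₂ = l₂ ; light₃ = l₃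
      ; largeCut = ≤-trans (*-monoˡ-≤-nonNeg (# 3 * ν n) {{nonNegative (3 · 0≤ν n)}}
          (+-monoʳ-≤ (E (𝟙 ⊟ ind Y)) (proj₂ opt (Z adm) (Z⊆Y adm)))) (largeCut adm)
      }

Max-upper : ∀ n (f : Fun n) v → f v ≤ Max n f
Max-upper (suc zero)    f zero    = ≤-refl
Max-upper (suc (suc n)) f zero    = p≤p⊔q (f zero) (Max (suc n) (f ∘ suc))
Max-upper (suc (suc n)) f (suc v) = ≤-trans (Max-upper (suc n) (f ∘ suc) v) (p≤q⊔p (f zero) (Max (suc n) (f ∘ suc)))

-- Colourings

module Colouring {n : ℕ} (G : WGraph n) where
  open Form G
  open Cuts G using (inside)

  class : Partition3 n → Fin 3 → VSet n
  class f c i = does (f i ≟ c)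

  classE : Partition3 n → Fin 3 → ℚ
  classE f c = E (ind (class f c))

  insideSum : Partition3 n → ℚ
  insideSum f = Σ 3 (classE f)

  classE-cong : ∀ {f g} → (∀ i → f i ≡ g i) → ∀ c → classE f c ≡ classE g c
  classE-cong h c = E-cong (λ i → cong (λ k → bit (does (k ≟ c))) (h i))

  ∈-class : ∀ f {c v} → v ∈ class f c → f v ≡ c
  ∈-class f {c} {v} h with f v ≟ c
  ... | yes eq = eq

  recolour : Partition3 n → Fin n → Fin 3 → Partition3 n
  recolour f v k i = if does (v ≟ i) then k else f i

  -- The coefficient is 1 for the new colour, -1 for the old one and 0 otherwise, also when both
  -- coincide, so no case distinction is needed later.
  class-recolour : ∀ f v k c i → ind (class (recolour f v k) c) i ≡ ind (class f c) i + (δ k c - δ (f v) c) * δ v i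
  class-recolour f v k c i with v ≟ i
  ... | yes refl = here (δ k c) (δ (f v) c)
    where
    here : ∀ x y → x ≡ y + (x - y) * 1ℚ
    here = solve-∀ ring
  ... | no _ = there (ind (class f c) i) (δ k c - δ (f v) c)
    where
    there : ∀ x y → x ≡ x + y * 0ℚ
    there = solve-∀ ring

  classE-recolour : ∀ f v k c → classE (recolour f v k) c ≡ classE f c + # 2 * (δ k c - δ (f v) c) * N (ind (class f c)) v
  classE-recolour f v k c = trans (E-cong (class-recolour f v k c)) (E-bump (δ k c - δ (f v) c) v (ind (class f c)))

  insideSum-recolour : ∀ f v k → insideSum (recolour f v k) ≡ insideSum f + # 2 * (N (ind (class f k)) v - N (ind (class f (f v))) v)
  insideSum-recolour f v k = begin
    Σ 3 (classE (recolour f v k))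
      ≡⟨ Σ-cong 3 (λ c → trans (classE-recolour f v k c) (expand (classE f c) (δ k c) (δ (f v) c) (g c))) ⟩
    Σ 3 (λ c → classE f c + (# 2 * (δ k c * g c) + - # 2 * (δ (f v) c * g c)))
      ≡⟨ Σ-+ 3 (classE f) (λ c → # 2 * (δ k c * g c) + - # 2 * (δ (f v) c * g c)) ⟩
    insideSum f + Σ 3 (λ c → # 2 * (δ k c * g c) + - # 2 * (δ (f v) c * g c))
      ≡⟨ cong (λ z → insideSum f + z) (Σ-+ 3 (λ c → # 2 * (δ k c * g c)) (λ c → - # 2 * (δ (f v) c * g c))) ⟩
    insideSum f + (Σ 3 (λ c → # 2 * (δ k c * g c)) + Σ 3 (λ c → - # 2 * (δ (f v) c * g c)))
      ≡⟨ cong₂ (λ x y → insideSum f + (x + y)) (trans (Σ-* 3 (# 2) (λ c → δ k c * g c)) (cong (# 2 *_) (Σ-δ 3 k g)))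
                                               (trans (Σ-* 3 (- # 2) (λ c → δ (f v) c * g c)) (cong (- # 2 *_) (Σ-δ 3 (f v) g))) ⟩
    insideSum f + (# 2 * g k + - # 2 * g (f v))
      ≡⟨ collect (insideSum f) (g k) (g (f v)) ⟩
    insideSum f + # 2 * (g k - g (f v)) ∎
    where
    open ≡-Reasoning
    g : Fin 3 → ℚ
    g c = N (ind (class f c)) v
    expand : ∀ e x y z → e + # 2 * (x - y) * z ≡ e + (# 2 * (x * z) + - # 2 * (y * z))
    expand = solve-∀ ring
    collect : ∀ e x y → e + (# 2 * x + - # 2 * y) ≡ e + # 2 * (x - y)
    collect = solve-∀ ring

  N-total : ∀ f v → Σ 3 (λ c → N (ind (class f c)) v) ≡ N 𝟙 v
  N-total f v = begin
    Σ 3 (λ c → N (ind (class f c)) v)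
      ≡⟨ Σ-cong 3 (λ c → N-def (ind (class f c)) v) ⟩
    Σ 3 (λ c → Σ n (λ u → w G v u * δ (f u) c))
      ≡⟨ Σ-comm 3 n (λ c u → w G v u * δ (f u) c) ⟩
    Σ n (λ u → Σ 3 (λ c → w G v u * δ (f u) c))
      ≡⟨ Σ-cong n (λ u → trans (Σ-cong 3 (λ c → *-comm (w G v u) (δ (f u) c))) (trans (Σ-δ 3 (f u) (λ _ → w G v u)) (≡-sym (*-identityʳ (w G v u))))) ⟩
    Σ n (λ u → w G v u * 1ℚ)
      ≡⟨ ≡-sym (N-def 𝟙 v) ⟩
    N 𝟙 v ∎
    where open ≡-Reasoning

  -- No recolouring of `v` pays, so its own class receives the least of the three degrees that add
  -- up to the full degree.
  optimal-local : ∀ f → (∀ g → insideSum f ≤ insideSum g) → ∀ v → # 3 * N (ind (class f (f v))) v ≤ N 𝟙 v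
  optimal-local f f-min v = subst₂ _≤_ (trans (Σ-const 3 (N (ind (class f (f v))) v)) (cong (_* N (ind (class f (f v))) v) (ν-def 3))) (N-total f v)
    (Σ-mono 3 {λ _ → N (ind (class f (f v))) v} {λ c → N (ind (class f c)) v} (λ c →
      cancel-≤ {r = # 2} (positive⁻¹ (# 2)) (slack (subst (insideSum f ≤_) (insideSum-recolour f v c) (f-min (recolour f v c))))
      (cert (insideSum f) (# 2 * (N (ind (class f c)) v - N (ind (class f (f v))) v)))))
    where
    cert : ∀ x y → x + y - x ≡ y
    cert = solve-∀ ring

  colouring : VSet n → VSet n → Partition3 n
  colouring Y Z i = if Y i then (if Z i then suc zero else suc (suc zero)) else zero

  module _ {Y Z : VSet n} (Z⊆Y : Z ⊆ Y) where

    class₀ : ∀ i → ind (class (colouring Y Z) zero) i ≡ (𝟙 ⊟ ind Y) i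
    class₀ i with Y i | Z i
    ... | true  | true  = refl
    ... | true  | false = refl
    ... | false | _     = refl

    class₁ : ∀ i → ind (class (colouring Y Z) (suc zero)) i ≡ ind Z i
    class₁ i with Y i in Yi | Z i in Zi
    ... | true  | true  = refl
    ... | true  | false = refl
    ... | false | true  = contradiction (trans (≡-sym (Z⊆Y Zi)) Yi) λ ()
    ... | false | false = refl

    class₂ : ∀ i → ind (class (colouring Y Z) (suc (suc zero))) i ≡ (ind Y ⊟ ind Z) i
    class₂ i with Y i in Yi | Z i in Zi
    ... | true  | true  = refl
    ... | true  | false = refl
    ... | false | true  = contradiction (trans (≡-sym (Z⊆Y Zi)) Yi) λ ()
    ... | false | false = refl

    insideSum-colouring : insideSum (colouring Y Z) ≡ inside Y Z
    insideSum-colouring = cong₂ _+_ (E-cong class₀)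
      (trans (cong₂ _+_ (E-cong class₁) (cong (_+ 0ℚ) (E-cong class₂)))
             (cong (λ z → E (ind Z) + z) (+-identityʳ (E (ind Y ⊟ ind Z)))))

-- Fair colourings and nonempty classes

module Fairness {n : ℕ} (G : WGraph n) (D : ℚ) (0≤D : 0ℚ ≤ D) (degree≤D : ∀ v → Form.N G 𝟙 v ≤ D) where
  open Form G
  open Cuts G
  open Colouring G
  open Peeling G D 0≤D degree≤D
  open Balancing G D 0≤D degree≤D hiding (optimal-local)

  record Fair (f : Partition3 n) : Set where
    field
      few   : # 3 * ν n * insideSum f ≤ (ν n - # 2) * T
      light : ∀ c → # 9 * classE f c ≤ τ

  judicious⇒fair : (j : Judicious) → Fair (colouring (Judicious.Y j) (Judicious.Z j))
  judicious⇒fair j = record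
    { few   = subst (λ z → # 3 * ν n * z ≤ (ν n - # 2) * T) (≡-sym (insideSum-colouring Z⊆Y)) largeCut
    ; light = λ where
        zero             → subst (λ z → # 9 * z ≤ τ) (≡-sym (E-cong (class₀ Z⊆Y))) light₁
        (suc zero)       → subst (λ z → # 9 * z ≤ τ) (≡-sym (E-cong (class₁ Z⊆Y))) light₂
        (suc (suc zero)) → subst (λ z → # 9 * z ≤ τ) (≡-sym (E-cong (class₂ Z⊆Y))) light₃
    }
    where open Judicious j

  fair-exists : 3 ℕ.≤ n → ∃ Fair
  fair-exists 3≤n = decide (all? (λ c → # 9 * classE f c ≤? τ))
    where
    -- The minimum is over all colourings, including those that miss a colour.
    best = function-hasMin (Fin-hasMin 2) n insideSum (λ h → Σ-cong 3 (classE-cong h))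
    f = proj₁ best
    f-min : ∀ g → insideSum f ≤ insideSum g
    f-min = proj₂ best
    few : # 3 * ν n * insideSum f ≤ (ν n - # 2) * T
    few = compare (balanced 3≤n)
      where
      compare : (∃ λ Y → ∃ λ Z → Z ⊆ Y × LargeCut Y Z) → # 3 * ν n * insideSum f ≤ (ν n - # 2) * T
      compare (Y , Z , Z⊆Y , bound) = ≤-trans (*-monoˡ-≤-nonNeg (# 3 * ν n) {{nonNegative (3 · 0≤ν n)}}
           (≤-trans (f-min (colouring Y Z)) (≤-reflexive (insideSum-colouring Z⊆Y)))) bound
    decide : Dec (∀ c → # 9 * classE f c ≤ τ) → ∃ Fair
    decide (yes light) = f , record { few = few ; light = light }
    decide (no ¬light) =
      let c , ¬l = ¬∀⟶∃¬ 3 (λ c → # 9 * classE f c ≤ τ) (λ c → # 9 * classE f c ≤? τ) ¬light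
          Y , adm = peel (class f c) (≰⇒> ¬l)
            (λ {v} v∈ → subst (λ k → # 3 * N (ind (class f k)) v ≤ N 𝟙 v) (∈-class f v∈) (optimal-local f f-min v))
          j = descend (size Y) Y refl adm
      in colouring (Judicious.Y j) (Judicious.Z j) , judicious⇒fair j

  Occupied : Partition3 n → Fin 3 → Set
  Occupied f c = ∃ λ v → f v ≡ c

  fair-mono : ∀ {f g} → (∀ c → classE g c ≤ classE f c) → Fair f → Fair g
  fair-mono h fair = record
    { few   = ≤-trans (*-monoˡ-≤-nonNeg (# 3 * ν n) {{nonNegative (3 · 0≤ν n)}} (Σ-mono 3 h)) (Fair.few fair)
    ; light = λ c → ≤-trans (*-monoˡ-≤-nonNeg (# 9) (h c)) (Fair.light fair c)
    }

  -- If `k` is missing, at least three vertices share two colours, so two of them agree. Giving `k`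
  -- to one adds no inside weight, and the other keeps their old class occupied.
  fill : 3 ℕ.≤ n → ∀ k f → Fair f → ∃ λ g → Fair g × Occupied g k × (∀ c → Occupied f c → Occupied g c)
  fill 3≤n k f fair = decide (any? (λ v → f v ≟ k))
    where
    decide : Dec (Occupied f k) → ∃ λ g → Fair g × Occupied g k × (∀ c → Occupied f c → Occupied g c)
    decide (yes occ) = f , fair , occ , λ _ occ → occ
    decide (no ¬occ) =
      let u , v , u<v , eq = pigeonhole 3≤n (λ i → punchOut (k≢ i))
          fu≡fv = punchOut-injective (k≢ u) (k≢ v) eq
      in recolour f u k , fair-mono (lighter u) fair , (u , cong (λ b → if b then k else f u) (dec-true (u ≟ u) refl)) , keep u v u<v fu≡fv
      where
      k≢ : ∀ i → k ≢ f i
      k≢ i eq = ¬occ (i , ≡-sym eq)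
      elsewhere : ∀ u i → u ≢ i → recolour f u k i ≡ f i
      elsewhere u i u≢i = cong (λ b → if b then k else f i) (dec-false (u ≟ i) u≢i)
      keep : ∀ u v → u <ᶠ v → f u ≡ f v → ∀ c → Occupied f c → Occupied (recolour f u k) c
      keep u v u<v fu≡fv c (i , fi≡c) with u ≟ i
      ... | no u≢i  = i , trans (elsewhere u i u≢i) fi≡c
      ... | yes refl = v , trans (elsewhere u v (Fin.<⇒≢ u<v)) (trans (≡-sym fu≡fv) fi≡c)
      empty : ∀ i → ind (class f k) i ≡ 0ℚ
      empty i = cong bit (dec-false (f i ≟ k) (λ eq → ¬occ (i , eq)))
      lighter : ∀ u c → classE (recolour f u k) c ≤ classE f c
      lighter u c = compare (k ≟ c)
        where
        y z : ℚ
        y = δ (f u) c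
        z = N (ind (class f c)) u
        compare : Dec (k ≡ c) → classE (recolour f u k) c ≤ classE f c
        compare (yes k≡c) = ≤-reflexive (trans (classE-recolour f u k c)
          (trans (cong (λ z → classE f c + # 2 * (δ k c - y) * z) (trans (N-cong (λ i → subst (λ c → ind (class f c) i ≡ 0ℚ) k≡c (empty i)) u) (N-𝟘 u)))
                 (void (classE f c) (# 2 * (δ k c - y)))))
          where
          void : ∀ x y → x + y * 0ℚ ≡ x
          void = solve-∀ ring
        compare (no k≢c) = subst (_≤ classE f c)
          (≡-sym (trans (classE-recolour f u k c) (cong (λ x → classE f c + # 2 * (x - y) * z) (cong bit (dec-false (k ≟ c) k≢c)))))
          (≤-by (2 · (0≤bit (does (f u ≟ c)) ⊗ 0≤N (λ i → 0≤bit (class f c i)) u)) (cert (classE f c) y z))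
          where
          cert : ∀ x y z → # 2 * (y * z) ≡ x - (x + # 2 * (0ℚ - y) * z)
          cert = solve-∀ ring

  fair-nonempty : 3 ℕ.≤ n → ∃ λ f → Fair f × NonEmptyParts f
  fair-nonempty 3≤n =
    let f  , fair  = fair-exists 3≤n
        f₀ , fair₀ , occ₀ , _     = fill 3≤n zero f fair
        f₁ , fair₁ , occ₁ , keep₁ = fill 3≤n (suc zero) f₀ fair₀
        f₂ , fair₂ , occ₂ , keep₂ = fill 3≤n (suc (suc zero)) f₁ fair₁
    in f₂ , fair₂ , λ where
         zero             → keep₂ zero (keep₁ zero occ₀)
         (suc zero)       → keep₂ (suc zero) occ₁
         (suc (suc zero)) → occ₂

-- Translation to sums over unordered pairs

module Bridge {n : ℕ} (G : WGraph n) where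
  open Form G
  open Colouring G

  private
    pick : Bool → ℚ → ℚ
    pick b x = if b then x else 0ℚ

  Σ² : (Fin n → Fin n → ℚ) → ℚ
  Σ² f = Σ n (λ i → Σ n (f i))

  Σ²-cong : ∀ {f g} → (∀ i j → f i j ≡ g i j) → Σ² f ≡ Σ² g
  Σ²-cong h = Σ-cong n (λ i → Σ-cong n (h i))

  Σ²-+ : ∀ f g → Σ² (λ i j → f i j + g i j) ≡ Σ² f + Σ² g
  Σ²-+ f g = trans (Σ-cong n (λ i → Σ-+ n (f i) (g i))) (Σ-+ n (λ i → Σ n (f i)) (λ i → Σ n (g i)))

  -- Transposing one copy yields the pairs in the opposite order; the diagonal is zero by
  -- looplessness.
  pairSum-double : ∀ P → (∀ i j → P i j ≡ P j i) → pairSum G P + pairSum G P ≡ Σ² (λ i j → pick (P i j) (w G i j))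
  pairSum-double P P-sym = begin
    pairSum G P + pairSum G P
      ≡⟨ cong (λ z → pairSum G P + z) (Σ-comm n n half) ⟩
    Σ² half + Σ² (λ i j → half j i)
      ≡⟨ ≡-sym (Σ²-+ half (λ i j → half j i)) ⟩
    Σ² (λ i j → half i j + half j i)
      ≡⟨ Σ²-cong unordered ⟩
    Σ² (λ i j → pick (P i j) (w G i j)) ∎
    where
    open ≡-Reasoning
    half : Fin n → Fin n → ℚ
    half i j = pick (does (i <? j) ∧ P i j) (w G i j)
    on : ∀ {i j} → i <ᶠ j → half i j ≡ pick (P i j) (w G i j)
    on {i} {j} i<j = cong (λ b → pick (b ∧ P i j) (w G i j)) (dec-true (i <? j) i<j)
    off : ∀ {i j} → ¬ (i <ᶠ j) → half i j ≡ 0ℚ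
    off {i} {j} i≮j = cong (λ b → pick (b ∧ P i j) (w G i j)) (dec-false (i <? j) i≮j)
    unordered : ∀ i j → half i j + half j i ≡ pick (P i j) (w G i j)
    unordered i j = compare (Fin.<-cmp i j)
      where
      compare : Tri (i <ᶠ j) (i ≡ j) (j <ᶠ i) → half i j + half j i ≡ pick (P i j) (w G i j)
      compare (tri< i<j _ j≮i) = trans (cong₂ _+_ (on i<j) (off j≮i)) (+-identityʳ (pick (P i j) (w G i j)))
      compare (tri> i≮j _ j<i) = trans (cong₂ _+_ (off i≮j) (on j<i)) (trans (+-identityˡ (pick (P j i) (w G j i))) (cong₂ pick (P-sym j i) (sym G j i)))
      compare (tri≈ i≮i refl _) = trans (cong₂ _+_ (off i≮i) (off i≮i)) (≡-sym (trans (cong (pick (P i i)) (loopless G i)) (void (P i i))))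
        where
        void : ∀ b → pick b 0ℚ ≡ 0ℚ
        void true  = refl
        void false = refl

  E-ind : ∀ X → E (ind X) ≡ Σ² (λ i j → pick (X i ∧ X j) (w G i j))
  E-ind X = trans (B-def (ind X) (ind X)) (Σ-cong n (λ i →
    trans (cong (ind X i *_) (N-def (ind X) i)) (trans (≡-sym (Σ-* n (ind X i) (λ j → w G i j * ind X j)))
      (Σ-cong n (λ j → product (X i) (X j) (w G i j))))))
    where
    product : ∀ b b′ x → bit b * (x * bit b′) ≡ pick (b ∧ b′) x
    product true  true  x = trans (*-identityˡ (x * 1ℚ)) (*-identityʳ x)
    product true  false x = trans (*-identityˡ (x * 0ℚ)) (*-zeroʳ x)
    product false b′    x = *-zeroˡ (x * bit b′)

  insideW-double : ∀ f c → classE f c ≡ insideW G f c + insideW G f c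
  insideW-double f c = trans (E-ind (class f c))
    (≡-sym (pairSum-double (λ i j → class f c i ∧ class f c j) (λ i j → ∧-comm (class f c i) (class f c j))))

  totalW-double : E 𝟙 ≡ totalW G + totalW G
  totalW-double = trans (E-ind (λ _ → true)) (≡-sym (pairSum-double (λ _ _ → true) (λ _ _ → refl)))

  totalW-split : ∀ f → totalW G ≡ crossW G f + Σ 3 (insideW G f)
  totalW-split f = begin
    totalW G
      ≡⟨ Σ²-cong (λ i j → separate (does (i <? j)) (f i) (f j) (w G i j)) ⟩
    Σ² (λ i j → cross i j + Σ 3 (λ c → within c i j))
      ≡⟨ Σ²-+ cross (λ i j → Σ 3 (λ c → within c i j)) ⟩
    crossW G f + Σ² (λ i j → Σ 3 (λ c → within c i j))
      ≡⟨ cong (λ z → crossW G f + z) (trans (Σ-cong n (λ i → Σ-comm n 3 (λ j c → within c i j))) (Σ-comm n 3 (λ i c → Σ n (within c i)))) ⟩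
    crossW G f + Σ 3 (insideW G f) ∎
    where
    open ≡-Reasoning
    cross : Fin n → Fin n → ℚ
    cross i j = pick (does (i <? j) ∧ not (does (f i ≟ f j))) (w G i j)
    within : Fin 3 → Fin n → Fin n → ℚ
    within c i j = pick (does (i <? j) ∧ (does (f i ≟ c) ∧ does (f j ≟ c))) (w G i j)
    separate : ∀ b (p q : Fin 3) x → pick (b ∧ true) x ≡ pick (b ∧ not (does (p ≟ q))) x + Σ 3 (λ c → pick (b ∧ (does (p ≟ c) ∧ does (q ≟ c))) x)
    separate false p q x = refl
    separate true  p q x = begin
      x
        ≡⟨ compare (p ≟ q) ⟩
      pick (not (does (p ≟ q))) x + pick (does (q ≟ p)) x
        ≡⟨ cong (λ z → pick (not (does (p ≟ q))) x + z) (≡-sym (Σ-δ 3 p (λ c → pick (does (q ≟ c)) x))) ⟩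
      pick (not (does (p ≟ q))) x + Σ 3 (λ c → δ p c * pick (does (q ≟ c)) x)
        ≡⟨ cong (λ z → pick (not (does (p ≟ q))) x + z) (Σ-cong 3 (λ c → product (does (p ≟ c)) (does (q ≟ c)))) ⟩
      pick (not (does (p ≟ q))) x + Σ 3 (λ c → pick (does (p ≟ c) ∧ does (q ≟ c)) x) ∎
      where
      product : ∀ a b → bit a * pick b x ≡ pick (a ∧ b) x
      product true  b = *-identityˡ (pick b x)
      product false b = *-zeroˡ (pick b x)
      compare : Dec (p ≡ q) → x ≡ pick (not (does (p ≟ q))) x + pick (does (q ≟ p)) x
      compare (yes p≡q) = ≡-sym (trans (cong₂ (λ a b → pick (not a) x + pick b x) (dec-true (p ≟ q) p≡q) (dec-true (q ≟ p) (≡-sym p≡q))) (+-identityˡ x))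
      compare (no p≢q)  = ≡-sym (trans (cong₂ (λ a b → pick (not a) x + pick b x) (dec-false (p ≟ q) p≢q) (dec-false (q ≟ p) (p≢q ∘ ≡-sym))) (+-identityʳ x))

  degree≤maxWDeg : ∀ v → N 𝟙 v ≤ maxWDeg G
  degree≤maxWDeg v = subst (_≤ maxWDeg G) (≡-sym (trans (N-def 𝟙 v) (Σ-cong n (λ u → *-identityʳ (w G v u))))) (Max-upper n (wdeg G) v)

-- Undoes the doubling: `t`, `J`, `C` are the true total, inside and crossing weights, and `r` is
-- the reciprocal in the average degree.
cut-bound : ∀ n r t J C {T I} → n * r ≡ 1ℚ → 0ℚ < n → T ≡ t + t → I ≡ J + J → t ≡ C + J →
  # 3 * n * I ≤ (n - # 2) * T → ((+ 2) / 3) * t + ((+ 1) / 3) * (((+ 2) / 1) * t * r) ≤ C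
cut-bound n r t J C nr n>0 refl refl refl h =
  cancel-≤ {r = # 6 * n} (0<-* (positive⁻¹ (# 6)) n>0) (slack h)
    (≡-sym (trans (cert n r J C) (trans (cong (λ z → # 6 * n * C - # 4 * n * (C + J) - # 4 * (C + J) * z) nr) (cert′ n J C))))
  where
  cert : ∀ n r J C → # 6 * n * (C - (((+ 2) / 3) * (C + J) + ((+ 1) / 3) * (((+ 2) / 1) * (C + J) * r)))
                   ≡ # 6 * n * C - # 4 * n * (C + J) - # 4 * (C + J) * (n * r)
  cert = solve-∀ ring
  cert′ : ∀ n J C → # 6 * n * C - # 4 * n * (C + J) - # 4 * (C + J) * 1ℚ ≡ (n - # 2) * (C + J + (C + J)) - # 3 * n * (J + J)
  cert′ = solve-∀ ring

part-bound : ∀ t D x {T y} → T ≡ t + t → y ≡ x + x → # 9 * y ≤ T + # 2 * D → x ≤ ((+ 1) / 9) * t + ((+ 1) / 9) * D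
part-bound t D x refl refl h = cancel-≤ {r = # 18} (positive⁻¹ (# 18)) (slack h) (cert t D x)
  where
  cert : ∀ t D x → t + t + # 2 * D - # 9 * (x + x) ≡ # 18 * (((+ 1) / 9) * t + ((+ 1) / 9) * D - x)
  cert = solve-∀ ring

theorem5 : ∀ (n : ℕ) → 3 ≤ℕ n → (G : WGraph n) →
    Σ[ f ∈ Partition3 n ] (NonEmptyParts f
    × (((+ 2) / 3) * totalW G + ((+ 1) / 3) * avgWDeg G ≤ crossW G f)
    × ((insideW G f zero ⊔ (insideW G f (suc zero) ⊔ insideW G f (suc (suc zero))))
    ≤ ((+ 1) / 9) * totalW G + ((+ 1) / 9) * maxWDeg G))
theorem5 (suc m) 3≤n G = conclude (fair-nonempty 3≤n)
  where
  open Form G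
  open Colouring G
  open Bridge G
  open Fairness G (maxWDeg G) (≤-trans (0≤N (λ _ → 0≤# 1) zero) (degree≤maxWDeg zero)) degree≤maxWDeg

  conclude : (∃ λ f → Fair f × NonEmptyParts f) →
    Σ[ f ∈ Partition3 (suc m) ] (NonEmptyParts f
    × (((+ 2) / 3) * totalW G + ((+ 1) / 3) * avgWDeg G ≤ crossW G f)
    × ((insideW G f zero ⊔ (insideW G f (suc zero) ⊔ insideW G f (suc (suc zero))))
    ≤ ((+ 1) / 9) * totalW G + ((+ 1) / 9) * maxWDeg G))
  conclude (f , fair , nonempty) = f , nonempty ,
    cut-bound (ν (suc m)) ((+ 1) / suc m) (totalW G) (Σ 3 (insideW G f)) (crossW G f)
      (trans (cong (ν (suc m) *_) (≡-sym (recip-def m))) (ν-recip m)) (0<ν-suc m)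
      totalW-double (trans (Σ-cong 3 (insideW-double f)) (Σ-+ 3 (insideW G f) (insideW G f))) (totalW-split f) (Fair.few fair) ,
    ⊔-lub (part zero) (⊔-lub (part (suc zero)) (part (suc (suc zero))))
    where
    part : ∀ c → insideW G f c ≤ ((+ 1) / 9) * totalW G + ((+ 1) / 9) * maxWDeg G
    part c = part-bound (totalW G) (maxWDeg G) (insideW G f c) totalW-double (insideW-double f c) (Fair.light fair c)
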